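{- Let $n\ge 1$ be arbitrary and let $T_n\in\mathcal{T}_n$. (a) For the hard-core model with $\boldsymbol{\lambda}=(1,\lambda)$ for arbitrary $\lambda>0$, we have $$Z^{\boldsymbol{\lambda}}(P_n,H_{\rm ind})\le Z^{\boldsymbol{\lambda}}(T_n,H_{\rm ind})\le Z^{\boldsymbol{\lambda}}(S_n,H_{\rm ind}).$$ (b) For the $k$-state Widom-Rowlinson model ($k\ge 1$) with $\boldsymbol{\lambda}=(1,\lambda_1,\ldots,\lambda_k)$ for arbitrary $\lambda_i>0$, we have $$Z^{\boldsymbol{\lambda}}(P_n,H_{{\rm WR}(k)})\le Z^{\boldsymbol{\lambda}}(T_n,H_{{\rm WR}(k)})\le Z^{\boldsymbol{\lambda}}(S_n,H_{{\rm WR}(k)}).$$ (c) For the capacity $C$ independent set model ($C\ge 1$ an integer) with $\boldsymbol{\lambda}=(1,\lambda,\ldots,\lambda^C)$ for arbitrary $\lambda>0$, we have $$Z^{\boldsymbol{\lambda}}(P_n,H_C)\le Z^{\boldsymbol{\lambda}}(T_n,H_C)\le Z^{\boldsymbol{\lambda}}(S_n,H_C).$$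
   Context: $\mathcal{T}_n$ is the set of all trees on $n$ vertices, $P_n$ is the path on $n$ vertices, and $S_n=K_{1,n-1}$ is the star on $n$ vertices. For a graph $H$ on vertex set $\{v_0,\ldots,v_k\}$ (no multiple edges, possibly with loops) and a simple loopless graph $G$, an $H$-coloring of $G$ is a map $f:V(G)\to V(H)$ such that $f(u)\sim_H f(v)$ whenever $u\sim_G v$; $\mathrm{Hom}(G,H)$ is the set of $H$-colorings of $G$. Given positive real activities $\boldsymbol{\lambda}=(\lambda_0,\ldots,\lambda_k)$, with $\lambda_i$ associated with $v_i$, the partition function is $Z^{\boldsymbol{\lambda}}(G,H)=\sum_{f\in\mathrm{Hom}(G,H)}\prod_{i=0}^k\lambda_i^{|f^{ -1}(v_i)|}$. $H_{\rm ind}$ is the graph on two vertices $v_{\rm out},v_{\rm in}$ joined by an edge, with a loop at $v_{\rm out}$ and no loop at $v_{\rm in}$; in (a), $v_{\rm out}$ has activity $1$ and $v_{\rm in}$ has activity $\lambda$. $H_{{\rm WR}(k)}$ is the fully looped star on vertices $v_0,\ldots,v_k$ with center $v_0$: its edges are $v_0v_i$ for $1\le i\le k$ together with a loop at every vertex; in (b), $v_0$ has activity $1$ and $v_i$ has activity $\lambda_i$ for $1\le i\le k$. $H_C$ is the graph on vertex set $\{0,1,\ldots,C\}$ with $a$ and $b$ adjacent (including possibly $a=b$, giving a loop) if and only if $a+b\le C$; in (c), vertex $i$ has activity $\lambda^i$. -}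

module Defs where

open import Algebra.Bundles.Raw using (RawSemiring)
import Algebra.Definitions.RawSemiring as RawSemiringDefinitions
open import Data.Fin.Base using (Fin; zero; suc; toℕ)
import Data.Fin.Properties as Fin
open import Data.List.Base as List using (List; []; _∷_; _∷ʳ_)
open import Data.List.Relation.Unary.Linked using (Linked)
open import Data.List.Relation.Unary.Unique.Propositional using (Unique)
open import Data.Nat.Base as ℕ using (ℕ; zero; suc)
import Data.Nat.Properties as ℕ
open import Data.Product.Base using (∃; _×_; _,_; proj₁; proj₂)
open import Data.Rational.Base as ℚ
  using (ℚ; 0ℚ; 1ℚ; ∣_∣; Positive; NonNegative; 1/_)
import Data.Rational.Properties as ℚ
open import Data.Rational.Solver using (module +-*-Solver)
open import Data.Sum.Base using (_⊎_; inj₁; inj₂; swap)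
open import Data.Vec.Base as Vec using (Vec; []; _∷_)
import Data.Vec.Functional as Vector
open import Level using (0ℓ)
open import Relation.Binary.Construct.Closure.ReflexiveTransitive using (Star)
open import Relation.Binary.Core using (Rel)
open import Relation.Binary.Definitions
  using (Decidable; Symmetric; Irreflexive)
open import Relation.Binary.PropositionalEquality
  using (_≡_; _≢_; refl; sym; trans; cong; cong₂; subst)
open import Relation.Nullary.Decidable
  using (Dec; ¬?; _×-dec_; _⊎-dec_; _→-dec_)
open import Relation.Nullary.Negation using (¬_)

-- Real numbers, as Cauchy sequences of rationals.  Distinct sequences
-- may represent the same real: equality is _≃_.
record ℝ : Set where
  field
    seq    : ℕ → ℚ
    cauchy : ∀ ε → 0ℚ ℚ.< ε → ∃ λ N → ∀ m n → N ℕ.≤ m → N ℕ.≤ n →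
             ∣ seq m ℚ.- seq n ∣ ℚ.≤ ε

open ℝ public

infix 4 _≤_ _<_ _≃_

_≤_ : Rel ℝ 0ℓ
x ≤ y = ∀ ε → 0ℚ ℚ.< ε → ∃ λ N → ∀ n → N ℕ.≤ n →
        seq x n ℚ.≤ seq y n ℚ.+ ε

_<_ : Rel ℝ 0ℓ
x < y = ∃ λ ε → 0ℚ ℚ.< ε × ∃ λ N → ∀ n → N ℕ.≤ n →
        seq x n ℚ.+ ε ℚ.≤ seq y n

_≃_ : Rel ℝ 0ℓ
x ≃ y = x ≤ y × y ≤ x

fromℚ : ℚ → ℝ
seq    (fromℚ q) _ = q
cauchy (fromℚ q) ε 0<ε = 0 , λ _ _ _ _ →
  subst (λ p → ∣ p ∣ ℚ.≤ ε) (sym (ℚ.+-inverseʳ q)) (ℚ.<⇒≤ 0<ε)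

0ℝ 1ℝ : ℝ
0ℝ = fromℚ 0ℚ
1ℝ = fromℚ 1ℚ

private
  open ℚ.≤-Reasoning

  scale : ∀ B → .{{Positive B}} → ∀ ε → 0ℚ ℚ.< ε →
          ∃ λ δ → 0ℚ ℚ.< δ × B ℚ.* δ ≡ ε
  scale B ε 0<ε = δ , 0<δ , Bδ≡ε
    where
    instance
      _ = ℚ.pos⇒nonZero B
      _ = ℚ.1/pos⇒pos B
      _ = ℚ.positive 0<ε
    δ = 1/ B ℚ.* ε
    0<δ = ℚ.positive⁻¹ δ {{ℚ.pos*pos⇒pos (1/ B) ε}}
    Bδ≡ε : B ℚ.* δ ≡ ε
    Bδ≡ε = trans (sym (ℚ.*-assoc B (1/ B) ε))
      (trans (cong (ℚ._* ε) (ℚ.*-inverseʳ B)) (ℚ.*-identityˡ ε))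

  *-mono-≤-nonNeg : ∀ {p q r s} → 0ℚ ℚ.≤ r → 0ℚ ℚ.≤ q →
                    p ℚ.≤ q → r ℚ.≤ s → p ℚ.* r ℚ.≤ q ℚ.* s
  *-mono-≤-nonNeg {p} {q} {r} {s} 0≤r 0≤q p≤q r≤s = ℚ.≤-trans
    (ℚ.*-monoʳ-≤-nonNeg r {{ℚ.nonNegative 0≤r}} p≤q)
    (ℚ.*-monoˡ-≤-nonNeg q {{ℚ.nonNegative 0≤q}} r≤s)

  eventuallyBounded : ∀ (x : ℝ) → ∃ λ B → Positive B × ∃ λ N →
                      ∀ n → N ℕ.≤ n → ∣ seq x n ∣ ℚ.≤ B
  eventuallyBounded x with cauchy x 1ℚ (ℚ.positive⁻¹ 1ℚ)
  ... | N , close = B , B>0 , N , bound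
    where
    B = 1ℚ ℚ.+ ∣ seq x N ∣
    B>0 : Positive B
    B>0 = ℚ.pos+nonNeg⇒pos 1ℚ ∣ seq x N ∣
            {{ℚ.nonNegative (ℚ.0≤∣p∣ (seq x N))}}
    bound : ∀ n → N ℕ.≤ n → ∣ seq x n ∣ ℚ.≤ B
    bound n N≤n = begin
      ∣ seq x n ∣
        ≡⟨ cong ∣_∣ (solve 2 (λ a b → a := (a :- b) :+ b) refl (seq x n) (seq x N)) ⟩
      ∣ (seq x n ℚ.- seq x N) ℚ.+ seq x N ∣
        ≤⟨ ℚ.∣p+q∣≤∣p∣+∣q∣ (seq x n ℚ.- seq x N) (seq x N) ⟩
      ∣ seq x n ℚ.- seq x N ∣ ℚ.+ ∣ seq x N ∣
        ≤⟨ ℚ.+-monoˡ-≤ ∣ seq x N ∣ (close n N N≤n ℕ.≤-refl) ⟩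
      B ∎
      where open +-*-Solver

  +-close : ∀ a b c d δ → ∣ a ℚ.- c ∣ ℚ.≤ δ → ∣ b ℚ.- d ∣ ℚ.≤ δ →
            ∣ (a ℚ.+ b) ℚ.- (c ℚ.+ d) ∣ ℚ.≤ (1ℚ ℚ.+ 1ℚ) ℚ.* δ
  +-close a b c d δ ac≤δ bd≤δ = begin
    ∣ (a ℚ.+ b) ℚ.- (c ℚ.+ d) ∣
      ≡⟨ cong ∣_∣ (solve 4 (λ a b c d →
           (a :+ b) :- (c :+ d) := (a :- c) :+ (b :- d)) refl a b c d) ⟩
    ∣ (a ℚ.- c) ℚ.+ (b ℚ.- d) ∣
      ≤⟨ ℚ.∣p+q∣≤∣p∣+∣q∣ (a ℚ.- c) (b ℚ.- d) ⟩
    ∣ a ℚ.- c ∣ ℚ.+ ∣ b ℚ.- d ∣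
      ≤⟨ ℚ.+-mono-≤ ac≤δ bd≤δ ⟩
    δ ℚ.+ δ
      ≡⟨ solve 1 (λ d → d :+ d := (con 1ℚ :+ con 1ℚ) :* d) refl δ ⟩
    (1ℚ ℚ.+ 1ℚ) ℚ.* δ ∎
    where open +-*-Solver

  *-close : ∀ a b c d A B δ → ∣ a ∣ ℚ.≤ A → ∣ d ∣ ℚ.≤ B →
            ∣ a ℚ.- c ∣ ℚ.≤ δ → ∣ b ℚ.- d ∣ ℚ.≤ δ →
            ∣ a ℚ.* b ℚ.- c ℚ.* d ∣ ℚ.≤ (A ℚ.+ B) ℚ.* δ
  *-close a b c d A B δ a≤A d≤B ac≤δ bd≤δ = begin
    ∣ a ℚ.* b ℚ.- c ℚ.* d ∣
      ≡⟨ cong ∣_∣ (solve 4 (λ a b c d →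
           a :* b :- c :* d := a :* (b :- d) :+ (a :- c) :* d) refl a b c d) ⟩
    ∣ a ℚ.* (b ℚ.- d) ℚ.+ (a ℚ.- c) ℚ.* d ∣
      ≤⟨ ℚ.∣p+q∣≤∣p∣+∣q∣ (a ℚ.* (b ℚ.- d)) ((a ℚ.- c) ℚ.* d) ⟩
    ∣ a ℚ.* (b ℚ.- d) ∣ ℚ.+ ∣ (a ℚ.- c) ℚ.* d ∣
      ≡⟨ cong₂ ℚ._+_ (ℚ.∣p*q∣≡∣p∣*∣q∣ a (b ℚ.- d))
                     (ℚ.∣p*q∣≡∣p∣*∣q∣ (a ℚ.- c) d) ⟩
    ∣ a ∣ ℚ.* ∣ b ℚ.- d ∣ ℚ.+ ∣ a ℚ.- c ∣ ℚ.* ∣ d ∣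
      ≤⟨ ℚ.+-mono-≤
           (*-mono-≤-nonNeg (ℚ.0≤∣p∣ (b ℚ.- d))
             (ℚ.≤-trans (ℚ.0≤∣p∣ a) a≤A) a≤A bd≤δ)
           (*-mono-≤-nonNeg (ℚ.0≤∣p∣ d)
             (ℚ.≤-trans (ℚ.0≤∣p∣ (a ℚ.- c)) ac≤δ) ac≤δ d≤B) ⟩
    A ℚ.* δ ℚ.+ δ ℚ.* B
      ≡⟨ solve 3 (λ a b d → a :* d :+ d :* b := (a :+ b) :* d) refl A B δ ⟩
    (A ℚ.+ B) ℚ.* δ ∎
    where open +-*-Solver

infixl 6 _+_
infixl 7 _*_

_+_ : ℝ → ℝ → ℝ
seq    (x + y) n = seq x n ℚ.+ seq y n
cauchy (x + y) ε 0<ε =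
  let δ , 0<δ , 2δ≡ε = scale (1ℚ ℚ.+ 1ℚ) ε 0<ε
      M , closeˣ     = cauchy x δ 0<δ
      N , closeʸ     = cauchy y δ 0<δ
  in M ℕ.⊔ N , λ m n ≤m ≤n → subst (_ ℚ.≤_) 2δ≡ε
       (+-close (seq x m) (seq y m) (seq x n) (seq y n) δ
         (closeˣ m n (ℕ.m⊔n≤o⇒m≤o M N ≤m) (ℕ.m⊔n≤o⇒m≤o M N ≤n))
         (closeʸ m n (ℕ.m⊔n≤o⇒n≤o M N ≤m) (ℕ.m⊔n≤o⇒n≤o M N ≤n)))

_*_ : ℝ → ℝ → ℝ
seq    (x * y) n = seq x n ℚ.* seq y n
cauchy (x * y) ε 0<ε =
  let A , A>0 , K , boundˣ = eventuallyBounded x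
      B , B>0 , L , boundʸ = eventuallyBounded y
      δ , 0<δ , [A+B]δ≡ε   =
        scale (A ℚ.+ B) {{ℚ.pos+pos⇒pos A {{A>0}} B {{B>0}}}} ε 0<ε
      M , closeˣ           = cauchy x δ 0<δ
      N , closeʸ           = cauchy y δ 0<δ
      KL = K ℕ.⊔ L
      MN = M ℕ.⊔ N
  in KL ℕ.⊔ MN , λ m n ≤m ≤n →
       let KL≤m = ℕ.m⊔n≤o⇒m≤o KL MN ≤m
           KL≤n = ℕ.m⊔n≤o⇒m≤o KL MN ≤n
           MN≤m = ℕ.m⊔n≤o⇒n≤o KL MN ≤m
           MN≤n = ℕ.m⊔n≤o⇒n≤o KL MN ≤n
       in subst (_ ℚ.≤_) [A+B]δ≡ε
            (*-close (seq x m) (seq y m) (seq x n) (seq y n) A B δ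
              (boundˣ m (ℕ.m⊔n≤o⇒m≤o K L KL≤m))
              (boundʸ n (ℕ.m⊔n≤o⇒n≤o K L KL≤n))
              (closeˣ m n (ℕ.m⊔n≤o⇒m≤o M N MN≤m) (ℕ.m⊔n≤o⇒m≤o M N MN≤n))
              (closeʸ m n (ℕ.m⊔n≤o⇒n≤o M N MN≤m) (ℕ.m⊔n≤o⇒n≤o M N MN≤n)))

ℝ-rawSemiring : RawSemiring 0ℓ 0ℓ
ℝ-rawSemiring = record
  { Carrier = ℝ
  ; _≈_     = _≃_
  ; _+_     = _+_
  ; _*_     = _*_
  ; 0#      = 0ℝ
  ; 1#      = 1ℝ
  }

open RawSemiringDefinitions ℝ-rawSemiring public using (_^_)

-- Loops are allowed: a vertex may be adjacent to itself.
record Graph (n : ℕ) : Set₁ where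
  field
    Adj     : Rel (Fin n) 0ℓ
    adj?    : Decidable Adj
    adj-sym : Symmetric Adj

record SimpleGraph (n : ℕ) : Set₁ where
  field
    graph    : Graph n
  open Graph graph public
  field
    loopless : Irreflexive _≡_ Adj

module _ {n} (G : SimpleGraph n) where
  open SimpleGraph G

  Connected : Set
  Connected = ∀ u v → Star Adj u v

  -- A cycle is a closed walk u, v, w, …, u through at least three
  -- vertices, with no repetition other than its two ends.
  Acyclic : Set
  Acyclic = ∀ u v w vs → let cycle = u ∷ v ∷ w ∷ vs in
            Unique cycle → ¬ Linked Adj (cycle ∷ʳ u)

-- Connectedness holds vacuously when n = 0, so the empty graph has to be
-- excluded separately.
IsTree : ∀ {n} → SimpleGraph n → Set
IsTree {n} G = 1 ℕ.≤ n × Connected G × Acyclic G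

pathGraph : ∀ n → SimpleGraph n
pathGraph n = record
  { graph = record
    { Adj     = λ i j → toℕ j ≡ suc (toℕ i) ⊎ toℕ i ≡ suc (toℕ j)
    ; adj?    = λ i j → (toℕ j ℕ.≟ suc (toℕ i)) ⊎-dec (toℕ i ℕ.≟ suc (toℕ j))
    ; adj-sym = swap
    }
  ; loopless = λ where
      refl (inj₁ eq) → ℕ.1+n≢n (sym eq)
      refl (inj₂ eq) → ℕ.1+n≢n (sym eq)
  }

-- The centre is the vertex numbered 0.
starGraph : ∀ n → SimpleGraph n
starGraph n = record
  { graph = record
    { Adj     = λ i j → i ≢ j × (toℕ i ≡ 0 ⊎ toℕ j ≡ 0)
    ; adj?    = λ i j → ¬? (i Fin.≟ j)
                        ×-dec ((toℕ i ℕ.≟ 0) ⊎-dec (toℕ j ℕ.≟ 0))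
    ; adj-sym = λ (i≢j , centre) → (λ j≡i → i≢j (sym j≡i)) , swap centre
    }
  ; loopless = λ i≡j (i≢j , _) → i≢j i≡j
  }

module _ {n q} (G : SimpleGraph n) (H : Graph q) where
  private
    module G = SimpleGraph G
    module H = Graph H

  -- A map Fin n → Fin q is represented by its vector of values.
  IsColouring : Vec (Fin q) n → Set
  IsColouring f = ∀ u v → G.Adj u v → H.Adj (Vec.lookup f u) (Vec.lookup f v)

  isColouring? : ∀ f → Dec (IsColouring f)
  isColouring? f = Fin.all? λ u → Fin.all? λ v →
    G.adj? u v →-dec H.adj? (Vec.lookup f u) (Vec.lookup f v)

-- Every vector is listed exactly once.
allMaps : ∀ n q → List (Vec (Fin q) n)
allMaps zero    q = [] ∷ []
allMaps (suc n) q = List.cartesianProductWith _∷_ (List.allFin q) (allMaps n q)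

Hom : ∀ {n q} → SimpleGraph n → Graph q → List (Vec (Fin q) n)
Hom {n} {q} G H = List.filter (isColouring? G H) (allMaps n q)

-- The semiring is a parameter because every operation of ℝ acts termwise
-- on sequences, so that the same formula is meaningful over ℚ.
module PartitionFunction (R : RawSemiring 0ℓ 0ℓ) where
  open RawSemiring R
    using (Carrier; 0#)
    renaming (_+_ to _⊕_)
  open RawSemiringDefinitions R
    using (product)
    renaming (_^_ to _↑_)

  weight : ∀ {n q} → (Fin q → Carrier) → Vec (Fin q) n → Carrier
  weight act f = product λ i → act i ↑ Vec.count (i Fin.≟_) f

  Z : ∀ {n q} → (Fin q → Carrier) → SimpleGraph n → Graph q → Carrier
  Z act G H = List.foldr _⊕_ 0# (List.map (weight act) (Hom G H))

open PartitionFunction ℝ-rawSemiring public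

v-out v-in : Fin 2
v-out = zero
v-in  = suc zero

H-ind : Graph 2
H-ind = record
  { Adj     = λ i j → i ≡ v-out ⊎ j ≡ v-out
  ; adj?    = λ i j → (i Fin.≟ v-out) ⊎-dec (j Fin.≟ v-out)
  ; adj-sym = swap
  }

H-WR : ∀ k → Graph (suc k)
H-WR k = record
  { Adj     = λ i j → i ≡ j ⊎ (i ≡ zero ⊎ j ≡ zero)
  ; adj?    = λ i j → (i Fin.≟ j) ⊎-dec ((i Fin.≟ zero) ⊎-dec (j Fin.≟ zero))
  ; adj-sym = λ where
      (inj₁ i≡j)    → inj₁ (sym i≡j)
      (inj₂ centre) → inj₂ (swap centre)
  }

H-cap : ∀ C → Graph (suc C)
H-cap C = record
  { Adj     = λ a b → toℕ a ℕ.+ toℕ b ℕ.≤ C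
  ; adj?    = λ a b → toℕ a ℕ.+ toℕ b ℕ.≤? C
  ; adj-sym = λ {a} {b} → subst (ℕ._≤ C) (ℕ.+-comm (toℕ a) (toℕ b))
  }

act-ind : ℝ → Fin 2 → ℝ
act-ind x = 1ℝ Vector.∷ x Vector.∷ Vector.[]

act-WR : ∀ {k} → (Fin k → ℝ) → Fin (suc k) → ℝ
act-WR xs = 1ℝ Vector.∷ xs

act-cap : ∀ {C} → ℝ → Fin (suc C) → ℝ
act-cap x i = x ^ toℕ i

{-# OPTIONS --safe #-}

-- Since every operation on reals acts termwise, it suffices to compare the
-- rational partition functions for nonnegative activities a.  Removing a
-- leaf replaces the weight f at its neighbour by f · A g, where g is the
-- weight of the leaf and (A g) i = Σ_{j ~ i} a_j g_j, so every tree reduces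
-- to a function of the colour of one vertex, built from 1 by (f , g) ↦ f · A g.
-- In each of the three models the colours carry a total preorder for which A
-- preserves nonnegative monotone functions; hence all these functions are
-- similarly ordered.  For a symmetric nonnegative kernel K the rearrangement
-- inequality then gives Σ a f (K g) ≤ Σ a f g (K 1), the Kelmans–Csikvári
-- shift along a path.  With K = A it detaches subtrees into leaves of one
-- centre, and with K = Aᵐ it merges paths hanging at a common root into one.

module Submission where

open import Defs
open import Algebra.Bundles using (CommutativeMonoid; CommutativeRing; Semiring)
import Algebra.Definitions.RawSemiring as RawSemiringDefinitions
import Algebra.Properties.CommutativeMonoid.Sum as MonoidSum
import Algebra.Properties.Semiring.Sum as SemiringSum
open import Data.Bool.Base using (if_then_else_)
open import Data.Empty using (⊥)
open import Data.Fin.Base using (Fin; zero; suc; punchIn; punchOut; toℕ)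
import Data.Fin.Properties as Fin
open import Data.List.Base as List using (List; []; _∷_; _++_; _∷ʳ_; length)
open import Data.List.Membership.Propositional.Properties using (∈-lookup; ∈-∃++)
open import Data.List.Properties using (map-∘; map-++; ++-assoc)
open import Data.List.Relation.Unary.All as All using ([]; _∷_)
import Data.List.Relation.Unary.All.Properties as All
open import Data.List.Relation.Unary.AllPairs using ([]; _∷_)
open import Data.List.Relation.Unary.Any using (any?)
open import Data.List.Relation.Unary.Linked using (Linked; []; [-]; _∷_)
import Data.List.Relation.Unary.Linked.Properties as Linked
open import Data.List.Relation.Unary.Unique.Propositional using (Unique)
import Data.List.Relation.Unary.Unique.Propositional.Properties as Unique
open import Data.Nat.Base as ℕ using (ℕ; zero; suc)
import Data.Nat.Properties as ℕ
open import Data.Nat.Solver using () renaming (module +-*-Solver to ℕ-Solver)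
open import Data.Product.Base using (_×_; _,_; proj₁; proj₂; ∃; ∃₂)
open import Data.Rational.Base as ℚ using (ℚ; 0ℚ; 1ℚ; nonNegative)
import Data.Rational.Properties as ℚ
open import Data.Rational.Solver using (module +-*-Solver)
open import Data.Sum.Base as Sum using (inj₁; inj₂)
open import Data.Unit.Base using (⊤)
open import Data.Vec.Base as Vec using (Vec; []; _∷_; lookup; insertAt)
open import Data.Vec.Functional using (updateAt)
open import Data.Vec.Functional.Properties using (updateAt-updates; updateAt-minimal)
open import Data.Vec.Properties using (insertAt-lookup; insertAt-punchIn)
open import Function.Base using (_∘_)
open import Function.Definitions using (Injective)
open import Level using (0ℓ)
open import Relation.Binary.Construct.Closure.ReflexiveTransitive using (Star; ε; _◅_; _◅◅_)
open import Relation.Binary.Core using (Rel)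
open import Relation.Binary.Definitions using (Total)
open import Relation.Binary.PropositionalEquality
open import Relation.Nullary.Decidable
  using (Dec; yes; no; does; ¬?; _×-dec_; dec-true; dec-false; decidable-stable)
open import Relation.Nullary.Negation using (contradiction; ¬_)
open import Relation.Unary using (Pred; Decidable)

ℚ-semiring : Semiring 0ℓ 0ℓ
ℚ-semiring = CommutativeRing.semiring ℚ.+-*-commutativeRing

open SemiringSum ℚ-semiring
  using (sum; sum-cong-≗; ∑-distrib-+; ∑-comm; *-distribˡ-sum; *-distribʳ-sum)
open PartitionFunction (Semiring.rawSemiring ℚ-semiring) using ()
  renaming (Z to Zℚ; weight to weightℚ)
open RawSemiringDefinitions (Semiring.rawSemiring ℚ-semiring) using (product)
  renaming (_^_ to _↑_)
open RawSemiringDefinitions ℝ-rawSemiring using () renaming (product to productℝ)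
open MonoidSum ℚ.*-1-commutativeMonoid using () renaming
  ( sum-cong-≗         to product-cong
  ; sum-remove         to product-remove
  ; ∑-distrib-+        to product-distrib-*
  ; sum-replicate-zero to product-1
  )
open MonoidSum ℕ.+-0-commutativeMonoid using () renaming
  ( sum                to sumℕ
  ; sum-remove         to sumℕ-remove
  ; sum-replicate-zero to sumℕ-zero
  )

private
  variable
    n q : ℕ
    X : Set

-- Inequalities between rational sums and products.

sum-mono : {f g : Fin n → ℚ} → (∀ i → f i ℚ.≤ g i) → sum f ℚ.≤ sum g
sum-mono {zero}  f≤g = ℚ.≤-refl
sum-mono {suc n} f≤g = ℚ.+-mono-≤ (f≤g zero) (sum-mono (λ i → f≤g (suc i)))

sum-nonNeg : {f : Fin n → ℚ} → (∀ i → 0ℚ ℚ.≤ f i) → 0ℚ ℚ.≤ sum f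
sum-nonNeg {zero}  0≤f = ℚ.≤-refl
sum-nonNeg {suc n} 0≤f = ℚ.+-mono-≤ (0≤f zero) (sum-nonNeg (λ i → 0≤f (suc i)))

*-nonNeg : ∀ {x y} → 0ℚ ℚ.≤ x → 0ℚ ℚ.≤ y → 0ℚ ℚ.≤ x ℚ.* y
*-nonNeg {x} {y} 0≤x 0≤y = ℚ.nonNegative⁻¹ (x ℚ.* y)
  {{ℚ.nonNeg*nonNeg⇒nonNeg x {{nonNegative 0≤x}} y {{nonNegative 0≤y}}}}

*-monoˡ : ∀ {x y z} → 0ℚ ℚ.≤ x → y ℚ.≤ z → x ℚ.* y ℚ.≤ x ℚ.* z
*-monoˡ {x} 0≤x = ℚ.*-monoˡ-≤-nonNeg x {{nonNegative 0≤x}}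

*-monoʳ : ∀ {x y z} → 0ℚ ℚ.≤ x → y ℚ.≤ z → y ℚ.* x ℚ.≤ z ℚ.* x
*-monoʳ {x} 0≤x = ℚ.*-monoʳ-≤-nonNeg x {{nonNegative 0≤x}}

*-mono : ∀ {w x y z} → 0ℚ ℚ.≤ y → 0ℚ ℚ.≤ x → w ℚ.≤ x → y ℚ.≤ z → w ℚ.* y ℚ.≤ x ℚ.* z
*-mono 0≤y 0≤x w≤x y≤z = ℚ.≤-trans (*-monoʳ 0≤y w≤x) (*-monoˡ 0≤x y≤z)

halve : ∀ {x y} → x ℚ.+ x ℚ.≤ y ℚ.+ y → x ℚ.≤ y
halve {x} {y} 2x≤2y = ℚ.≮⇒≥ λ y<x → ℚ.<-irrefl refl (ℚ.<-≤-trans (ℚ.+-mono-< y<x y<x) 2x≤2y)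

-- The right side exceeds the left by `(b - a) * (d - c)`, a product of nonnegative factors.
rearrangement : ∀ {a b c d} → a ℚ.≤ b → c ℚ.≤ d → a ℚ.* d ℚ.+ b ℚ.* c ℚ.≤ a ℚ.* c ℚ.+ b ℚ.* d
rearrangement {a} {b} {c} {d} a≤b c≤d = begin
  a ℚ.* d ℚ.+ b ℚ.* c
    ≡⟨ ℚ.+-identityʳ (a ℚ.* d ℚ.+ b ℚ.* c) ⟨
  a ℚ.* d ℚ.+ b ℚ.* c ℚ.+ 0ℚ
    ≤⟨ ℚ.+-monoʳ-≤ (a ℚ.* d ℚ.+ b ℚ.* c) (*-nonNeg (difference a≤b) (difference c≤d)) ⟩
  a ℚ.* d ℚ.+ b ℚ.* c ℚ.+ (b ℚ.- a) ℚ.* (d ℚ.- c)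
    ≡⟨ solve 4 (λ a b c d → a :* d :+ b :* c :+ (b :- a) :* (d :- c)
                          := a :* c :+ b :* d) refl a b c d ⟩
  a ℚ.* c ℚ.+ b ℚ.* d ∎
  where
  open ℚ.≤-Reasoning
  open +-*-Solver
  difference : ∀ {x y} → x ℚ.≤ y → 0ℚ ℚ.≤ y ℚ.- x
  difference {x} {y} x≤y = subst (ℚ._≤ y ℚ.- x) (ℚ.+-inverseʳ x) (ℚ.+-monoˡ-≤ (ℚ.- x) x≤y)

-- Activity-weighted sums and symmetric kernels.

module Weighted (a : Fin q → ℚ) where

  infixr 7 _⊙_ _⊡_ _⊠_

  -- Sums over the colour of a root. The root's activity enters only here, so functions describing
  -- branches leave it out.
  ⟨_⟩ : (Fin q → ℚ) → ℚ
  ⟨ f ⟩ = sum λ i → a i ℚ.* f i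

  _⊙_ : (Fin q → ℚ) → (Fin q → ℚ) → Fin q → ℚ
  (f ⊙ g) i = f i ℚ.* g i

  -- The activity is part of the operator, which makes a symmetric `M` self-adjoint for the inner
  -- product `⟨ f ⊙ g ⟩`.
  _⊡_ : (Fin q → Fin q → ℚ) → (Fin q → ℚ) → Fin q → ℚ
  (M ⊡ f) i = sum λ j → M i j ℚ.* (a j ℚ.* f j)

  𝟙 : Fin q → ℚ
  𝟙 _ = 1ℚ

  ⟨⟩-cong : ∀ {f g} → f ≗ g → ⟨ f ⟩ ≡ ⟨ g ⟩
  ⟨⟩-cong f≗g = sum-cong-≗ λ i → cong (a i ℚ.*_) (f≗g i)

  ⊡-cong : ∀ M {f g} → f ≗ g → M ⊡ f ≗ M ⊡ g
  ⊡-cong M f≗g i = sum-cong-≗ λ j → cong (λ x → M i j ℚ.* (a j ℚ.* x)) (f≗g j)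

  -- The matrix product `M D N`, with `D` the diagonal matrix of activities; this is the kernel of
  -- the composed operators.
  _⊠_ : (M N : Fin q → Fin q → ℚ) → Fin q → Fin q → ℚ
  (M ⊠ N) i j = (M ⊡ λ k → N k j) i

  ⊠-⊡-assoc : ∀ M N f → (M ⊠ N) ⊡ f ≗ M ⊡ N ⊡ f
  ⊠-⊡-assoc M N f i = begin
    sum (λ j → sum (λ k → M i k ℚ.* (a k ℚ.* N k j)) ℚ.* (a j ℚ.* f j))
      ≡⟨ sum-cong-≗ (λ j → *-distribʳ-sum (a j ℚ.* f j) λ k → M i k ℚ.* (a k ℚ.* N k j)) ⟩
    sum (λ j → sum λ k → M i k ℚ.* (a k ℚ.* N k j) ℚ.* (a j ℚ.* f j))
      ≡⟨ ∑-comm (λ j k → M i k ℚ.* (a k ℚ.* N k j) ℚ.* (a j ℚ.* f j)) ⟩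
    sum (λ k → sum λ j → M i k ℚ.* (a k ℚ.* N k j) ℚ.* (a j ℚ.* f j))
      ≡⟨ sum-cong-≗ (λ k → sum-cong-≗ λ j → reassociate (M i k) (a k) (N k j) (a j ℚ.* f j)) ⟩
    sum (λ k → sum λ j → M i k ℚ.* a k ℚ.* (N k j ℚ.* (a j ℚ.* f j)))
      ≡⟨ sum-cong-≗ (λ k → *-distribˡ-sum (M i k ℚ.* a k) λ j → N k j ℚ.* (a j ℚ.* f j)) ⟨
    sum (λ k → M i k ℚ.* a k ℚ.* (N ⊡ f) k)
      ≡⟨ sum-cong-≗ (λ k → ℚ.*-assoc (M i k) (a k) ((N ⊡ f) k)) ⟩
    (M ⊡ N ⊡ f) i ∎
    where
    open ≡-Reasoning
    reassociate : ∀ m x n y → m ℚ.* (x ℚ.* n) ℚ.* y ≡ m ℚ.* x ℚ.* (n ℚ.* y)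
    reassociate = solve 4 (λ m x n y → m :* (x :* n) :* y := m :* x :* (n :* y)) refl
      where open +-*-Solver

  -- Collects the kernel and both activities into one coefficient, which is symmetric in `i` and `j`
  -- whenever `M` is.
  form-expand : ∀ M f g →
                ⟨ f ⊙ M ⊡ g ⟩ ≡ sum λ i → sum λ j → a i ℚ.* a j ℚ.* M i j ℚ.* (f i ℚ.* g j)
  form-expand M f g = sum-cong-≗ λ i → begin
    a i ℚ.* (f i ℚ.* (M ⊡ g) i)
      ≡⟨ ℚ.*-assoc (a i) (f i) ((M ⊡ g) i) ⟨
    a i ℚ.* f i ℚ.* (M ⊡ g) i
      ≡⟨ *-distribˡ-sum (a i ℚ.* f i) (λ j → M i j ℚ.* (a j ℚ.* g j)) ⟩
    sum (λ j → a i ℚ.* f i ℚ.* (M i j ℚ.* (a j ℚ.* g j)))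
      ≡⟨ sum-cong-≗ (λ j → reassociate (a i) (f i) (M i j) (a j) (g j)) ⟩
    sum (λ j → a i ℚ.* a j ℚ.* M i j ℚ.* (f i ℚ.* g j)) ∎
    where
    open ≡-Reasoning
    reassociate : ∀ x f m y g → x ℚ.* f ℚ.* (m ℚ.* (y ℚ.* g)) ≡ x ℚ.* y ℚ.* m ℚ.* (f ℚ.* g)
    reassociate = solve 5 (λ x f m y g →
      x :* f :* (m :* (y :* g)) := x :* y :* m :* (f :* g)) refl
      where open +-*-Solver

  module Symmetric {M : Fin q → Fin q → ℚ} (M-sym : ∀ i j → M i j ≡ M j i) where

    coeff-sym : ∀ i j → a i ℚ.* a j ℚ.* M i j ≡ a j ℚ.* a i ℚ.* M j i
    coeff-sym i j = cong₂ ℚ._*_ (ℚ.*-comm (a i) (a j)) (M-sym i j)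

    -- For `M = A` this moves the root across an edge: either end may be the one whose colour is
    -- summed last.
    self-adjoint : ∀ f g → ⟨ f ⊙ M ⊡ g ⟩ ≡ ⟨ g ⊙ M ⊡ f ⟩
    self-adjoint f g = begin
      ⟨ f ⊙ M ⊡ g ⟩
        ≡⟨ form-expand M f g ⟩
      sum (λ i → sum λ j → a i ℚ.* a j ℚ.* M i j ℚ.* (f i ℚ.* g j))
        ≡⟨ ∑-comm (λ i j → a i ℚ.* a j ℚ.* M i j ℚ.* (f i ℚ.* g j)) ⟩
      sum (λ j → sum λ i → a i ℚ.* a j ℚ.* M i j ℚ.* (f i ℚ.* g j))
        ≡⟨ sum-cong-≗ (λ j → sum-cong-≗ λ i →
             cong₂ ℚ._*_ (coeff-sym i j) (ℚ.*-comm (f i) (g j))) ⟩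
      sum (λ j → sum λ i → a j ℚ.* a i ℚ.* M j i ℚ.* (g j ℚ.* f i))
        ≡⟨ form-expand M g f ⟨
      ⟨ g ⊙ M ⊡ f ⟩ ∎
      where open ≡-Reasoning

    -- The inequality is the symmetrised rearrangement inequality: doubling
    -- both sides pairs the terms (i , j) and (j , i).
    merge-≤ : (∀ i → 0ℚ ℚ.≤ a i) → (∀ i j → 0ℚ ℚ.≤ M i j) → ∀ {f g} →
              (∀ i j → f i ℚ.* g j ℚ.+ f j ℚ.* g i ℚ.≤ f i ℚ.* g i ℚ.+ f j ℚ.* g j) →
              ⟨ f ⊙ M ⊡ g ⟩ ℚ.≤ ⟨ (f ⊙ g) ⊙ M ⊡ 𝟙 ⟩
    merge-≤ 0≤a 0≤M {f} {g} ordered = halve (begin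
      ⟨ f ⊙ M ⊡ g ⟩ ℚ.+ ⟨ f ⊙ M ⊡ g ⟩
        ≡⟨ cong₂ ℚ._+_ (form-expand M f g) (trans (self-adjoint f g) (form-expand M g f)) ⟩
      Σ² (λ i j → f i ℚ.* g j) ℚ.+ Σ² (λ i j → g i ℚ.* f j)
        ≡⟨ Σ²-+ (λ i j → f i ℚ.* g j) (λ i j → g i ℚ.* f j) ⟨
      Σ² (λ i j → f i ℚ.* g j ℚ.+ g i ℚ.* f j)
        ≤⟨ sum-mono (λ i → sum-mono λ j →
             *-monoˡ (*-nonNeg (*-nonNeg (0≤a i) (0≤a j)) (0≤M i j)) (termwise i j)) ⟩
      Σ² (λ i j → f i ℚ.* g i ℚ.* 1ℚ ℚ.+ 1ℚ ℚ.* (f j ℚ.* g j))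
        ≡⟨ Σ²-+ (λ i j → f i ℚ.* g i ℚ.* 1ℚ) (λ i j → 1ℚ ℚ.* (f j ℚ.* g j)) ⟩
      Σ² (λ i j → f i ℚ.* g i ℚ.* 1ℚ) ℚ.+ Σ² (λ i j → 1ℚ ℚ.* (f j ℚ.* g j))
        ≡⟨ cong₂ ℚ._+_ (form-expand M (f ⊙ g) 𝟙)
             (trans (self-adjoint (f ⊙ g) 𝟙) (form-expand M 𝟙 (f ⊙ g))) ⟨
      ⟨ (f ⊙ g) ⊙ M ⊡ 𝟙 ⟩ ℚ.+ ⟨ (f ⊙ g) ⊙ M ⊡ 𝟙 ⟩ ∎)
      where
      open ℚ.≤-Reasoning
      Σ² : (Fin q → Fin q → ℚ) → ℚ
      Σ² h = sum λ i → sum λ j → a i ℚ.* a j ℚ.* M i j ℚ.* h i j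
      Σ²-+ : ∀ h k → Σ² (λ i j → h i j ℚ.+ k i j) ≡ Σ² h ℚ.+ Σ² k
      Σ²-+ h k = trans
        (sum-cong-≗ λ i → trans
          (sum-cong-≗ λ j → ℚ.*-distribˡ-+ (a i ℚ.* a j ℚ.* M i j) (h i j) (k i j))
          (∑-distrib-+ (λ j → a i ℚ.* a j ℚ.* M i j ℚ.* h i j)
                       (λ j → a i ℚ.* a j ℚ.* M i j ℚ.* k i j)))
        (∑-distrib-+ (λ i → sum λ j → a i ℚ.* a j ℚ.* M i j ℚ.* h i j)
                     (λ i → sum λ j → a i ℚ.* a j ℚ.* M i j ℚ.* k i j))
      termwise : ∀ i j → f i ℚ.* g j ℚ.+ g i ℚ.* f j ℚ.≤ f i ℚ.* g i ℚ.* 1ℚ ℚ.+ 1ℚ ℚ.* (f j ℚ.* g j)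
      termwise i j = subst₂ ℚ._≤_
        (cong (f i ℚ.* g j ℚ.+_) (ℚ.*-comm (f j) (g i)))
        (cong₂ ℚ._+_ (sym (ℚ.*-identityʳ (f i ℚ.* g i))) (sym (ℚ.*-identityˡ (f j ℚ.* g j))))
        (ordered i j)

-- Rooted trees and the extremal inequalities in an ordered model.

-- attach s t joins the roots of s and t by an edge and keeps the root of s.
data RootedTree : Set where
  single : RootedTree
  attach : RootedTree → RootedTree → RootedTree

edges : RootedTree → ℕ
edges single       = 0
edges (attach s t) = edges s ℕ.+ suc (edges t)

-- Nonnegativity is bundled in so that pointwise products of monotone functions are again monotone.
record Monotone (_≼_ : Rel (Fin q) 0ℓ) (f : Fin q → ℚ) : Set where
  field
    nonNeg : ∀ i → 0ℚ ℚ.≤ f i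
    mono   : ∀ {i j} → i ≼ j → f i ℚ.≤ f j

open Monotone

-- Through `total` any two monotone functions are similarly ordered, and through `⊡-mono` every
-- branch function is monotone.
record IsOrderedModel (A : Fin q → Fin q → ℚ) (a : Fin q → ℚ) (_≼_ : Rel (Fin q) 0ℓ) : Set where
  open Weighted a
  field
    a-nonNeg : ∀ i → 0ℚ ℚ.≤ a i
    A-nonNeg : ∀ i j → 0ℚ ℚ.≤ A i j
    A-sym    : ∀ i j → A i j ≡ A j i
    total    : Total _≼_
    ⊡-mono   : ∀ {f} → Monotone _≼_ f → ∀ {i j} → i ≼ j → (A ⊡ f) i ℚ.≤ (A ⊡ f) j

module RootedPartition (A : Fin q → Fin q → ℚ) (a : Fin q → ℚ) where
  open Weighted a

  -- The weight of all colourings of the tree with a prescribed root colour, without the activity of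
  -- the root.
  branch : RootedTree → Fin q → ℚ
  branch single       = 𝟙
  branch (attach s t) = branch s ⊙ A ⊡ branch t

  starRoot : ℕ → Fin q → ℚ
  starRoot zero    = 𝟙
  starRoot (suc m) = (A ⊡ 𝟙) ⊙ starRoot m

  -- A path with `m` edges hanging at the root and carrying `f` at its far end.
  walk : ℕ → (Fin q → ℚ) → Fin q → ℚ
  walk zero    f = f
  walk (suc m) f = A ⊡ walk m f

  walk-+ : ∀ m k f → walk (m ℕ.+ k) f ≗ walk m (walk k f)
  walk-+ zero    k f i = refl
  walk-+ (suc m) k f i = ⊡-cong A (walk-+ m k f) i

  module Bounds {_≼_ : Rel (Fin q) 0ℓ} (model : IsOrderedModel A a _≼_) where
    open IsOrderedModel model
    open Symmetric A-sym using (self-adjoint)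

    𝟙-monotone : Monotone _≼_ 𝟙
    𝟙-monotone .nonNeg _ = ℚ.nonNegative⁻¹ 1ℚ
    𝟙-monotone .mono _   = ℚ.≤-refl

    ⊙-monotone : ∀ {f g} → Monotone _≼_ f → Monotone _≼_ g → Monotone _≼_ (f ⊙ g)
    ⊙-monotone F G .nonNeg i = *-nonNeg (F .nonNeg i) (G .nonNeg i)
    ⊙-monotone F G .mono {i} {j} i≼j =
      *-mono (G .nonNeg i) (F .nonNeg j) (F .mono i≼j) (G .mono i≼j)

    ⊡-monotone : ∀ {f} → Monotone _≼_ f → Monotone _≼_ (A ⊡ f)
    ⊡-monotone F .nonNeg i = sum-nonNeg λ j →
      *-nonNeg (A-nonNeg i j) (*-nonNeg (a-nonNeg j) (F .nonNeg j))
    ⊡-monotone F .mono = ⊡-mono F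

    walk-monotone : ∀ m {f} → Monotone _≼_ f → Monotone _≼_ (walk m f)
    walk-monotone zero    F = F
    walk-monotone (suc m) F = ⊡-monotone (walk-monotone m F)

    branch-monotone : ∀ t → Monotone _≼_ (branch t)
    branch-monotone single       = 𝟙-monotone
    branch-monotone (attach s t) =
      ⊙-monotone (branch-monotone s) (⊡-monotone (branch-monotone t))

    similarlyOrdered : ∀ {f g} → Monotone _≼_ f → Monotone _≼_ g →
                       ∀ i j → f i ℚ.* g j ℚ.+ f j ℚ.* g i ℚ.≤ f i ℚ.* g i ℚ.+ f j ℚ.* g j
    similarlyOrdered {f} {g} F G i j with total i j
    ... | inj₁ i≼j = rearrangement (F .mono i≼j) (G .mono i≼j)
    ... | inj₂ j≼i = subst₂ ℚ._≤_
      (ℚ.+-comm (f j ℚ.* g i) (f i ℚ.* g j)) (ℚ.+-comm (f j ℚ.* g j) (f i ℚ.* g i))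
      (rearrangement (F .mono j≼i) (G .mono j≼i))

    -- Index `m` stands for `m + 1` steps. A kernel for zero steps would have inverse activities on
    -- its diagonal, and activities may vanish.
    walkKernel : ℕ → Fin q → Fin q → ℚ
    walkKernel zero    = A
    walkKernel (suc m) = A ⊠ walkKernel m

    walkKernel-nonNeg : ∀ m i j → 0ℚ ℚ.≤ walkKernel m i j
    walkKernel-nonNeg zero    = A-nonNeg
    walkKernel-nonNeg (suc m) i j = sum-nonNeg λ k →
      *-nonNeg (A-nonNeg i k) (*-nonNeg (a-nonNeg k) (walkKernel-nonNeg m k j))

    walkKernel-comm : ∀ m i j → (A ⊠ walkKernel m) i j ≡ (walkKernel m ⊠ A) i j
    walkKernel-comm zero    i j = refl
    walkKernel-comm (suc m) i j = trans
      (⊡-cong A (λ k → walkKernel-comm m k j) i)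
      (sym (⊠-⊡-assoc A (walkKernel m) (λ k → A k j) i))

    -- Transposing `A ⊠ walkKernel m` reverses the order of its symmetric factors; since powers of
    -- `A` commute with `A`, the result is the same kernel.
    walkKernel-sym : ∀ m i j → walkKernel m i j ≡ walkKernel m j i
    walkKernel-sym zero    = A-sym
    walkKernel-sym (suc m) i j = trans
      (sum-cong-≗ λ k → trans
        (swap-outer (A i k) (a k) (walkKernel m k j))
        (cong₂ (λ x y → x ℚ.* (a k ℚ.* y)) (walkKernel-sym m k j) (A-sym i k)))
      (sym (walkKernel-comm m j i))
      where
      swap-outer : ∀ x y z → x ℚ.* (y ℚ.* z) ≡ z ℚ.* (y ℚ.* x)
      swap-outer = solve 3 (λ x y z → x :* (y :* z) := z :* (y :* x)) refl
        where open +-*-Solver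

    walk-kernel : ∀ m f → walk (suc m) f ≗ walkKernel m ⊡ f
    walk-kernel zero    f i = refl
    walk-kernel (suc m) f i = trans
      (⊡-cong A (walk-kernel m f) i) (sym (⊠-⊡-assoc A (walkKernel m) f i))

    -- The Kelmans–Csikvári shift: the branches f and g at the two ends of a
    -- path are both moved to one end.
    walk-merge : ∀ m {f g} → Monotone _≼_ f → Monotone _≼_ g →
                 ⟨ f ⊙ walk m g ⟩ ℚ.≤ ⟨ f ⊙ g ⊙ walk m 𝟙 ⟩
    walk-merge zero {f} {g} F G =
      ℚ.≤-reflexive (⟨⟩-cong λ i → cong (f i ℚ.*_) (sym (ℚ.*-identityʳ (g i))))
    walk-merge (suc m) {f} {g} F G = begin
      ⟨ f ⊙ walk (suc m) g ⟩
        ≡⟨ ⟨⟩-cong (λ i → cong (f i ℚ.*_) (walk-kernel m g i)) ⟩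
      ⟨ f ⊙ walkKernel m ⊡ g ⟩
        ≤⟨ Symmetric.merge-≤ (walkKernel-sym m) a-nonNeg (walkKernel-nonNeg m) {f} {g}
             (similarlyOrdered F G) ⟩
      ⟨ (f ⊙ g) ⊙ walkKernel m ⊡ 𝟙 ⟩
        ≡⟨ ⟨⟩-cong (λ i → trans
             (cong (f i ℚ.* g i ℚ.*_) (sym (walk-kernel m 𝟙 i)))
             (ℚ.*-assoc (f i) (g i) (walk (suc m) 𝟙 i))) ⟩
      ⟨ f ⊙ g ⊙ walk (suc m) 𝟙 ⟩ ∎
      where open ℚ.≤-Reasoning

    starRoot-+ : ∀ m k → starRoot (m ℕ.+ k) ≗ starRoot m ⊙ starRoot k
    starRoot-+ zero    k i = sym (ℚ.*-identityˡ (starRoot k i))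
    starRoot-+ (suc m) k i = trans
      (cong ((A ⊡ 𝟙) i ℚ.*_) (starRoot-+ m k i))
      (sym (ℚ.*-assoc ((A ⊡ 𝟙) i) (starRoot m i) (starRoot k i)))

    starRoot-monotone : ∀ m → Monotone _≼_ (starRoot m)
    starRoot-monotone zero    = 𝟙-monotone
    starRoot-monotone (suc m) = ⊙-monotone (⊡-monotone 𝟙-monotone) (starRoot-monotone m)

    -- The function `h` stands for everything else attached to the root, which lets the two subtrees
    -- be turned into leaves one after the other, each time with the rest absorbed into `h`.
    branch≤star : ∀ t {h} → Monotone _≼_ h → ⟨ h ⊙ branch t ⟩ ℚ.≤ ⟨ h ⊙ starRoot (edges t) ⟩
    branch≤star single       H = ℚ.≤-refl
    branch≤star (attach s t) {h} H = begin
      ⟨ h ⊙ branch s ⊙ A ⊡ branch t ⟩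
        ≡⟨ ⟨⟩-cong (λ i → ℚ.*-assoc (h i) (branch s i) ((A ⊡ branch t) i)) ⟨
      ⟨ (h ⊙ branch s) ⊙ walk 1 (branch t) ⟩
        -- The shift along the joining edge brings `branch t` to the root of `s` and leaves a
        -- pendant leaf, the factor `A ⊡ 𝟙`.
        ≤⟨ walk-merge 1 (⊙-monotone H (branch-monotone s)) (branch-monotone t) ⟩
      ⟨ (h ⊙ branch s) ⊙ branch t ⊙ A ⊡ 𝟙 ⟩
        ≡⟨ ⟨⟩-cong (λ i → solve 4 (λ h s t d →
             (h :* s) :* (t :* d) := (h :* s :* d) :* t) refl
             (h i) (branch s i) (branch t i) ((A ⊡ 𝟙) i)) ⟩
      ⟨ ((h ⊙ branch s) ⊙ (A ⊡ 𝟙)) ⊙ branch t ⟩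
        ≤⟨ branch≤star t (⊙-monotone (⊙-monotone H (branch-monotone s)) (⊡-monotone 𝟙-monotone)) ⟩
      ⟨ ((h ⊙ branch s) ⊙ (A ⊡ 𝟙)) ⊙ starRoot (edges t) ⟩
        ≡⟨ ⟨⟩-cong (λ i → solve 4 (λ h s d r →
             (h :* s :* d) :* r := (h :* (d :* r)) :* s) refl
             (h i) (branch s i) ((A ⊡ 𝟙) i) (starRoot (edges t) i)) ⟩
      ⟨ (h ⊙ starRoot (suc (edges t))) ⊙ branch s ⟩
        ≤⟨ branch≤star s (⊙-monotone H (starRoot-monotone (suc (edges t)))) ⟩
      ⟨ (h ⊙ starRoot (suc (edges t))) ⊙ starRoot (edges s) ⟩
        ≡⟨ ⟨⟩-cong (λ i → trans
             (solve 3 (λ h r s → (h :* r) :* s := h :* (s :* r)) refl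
               (h i) (starRoot (suc (edges t)) i) (starRoot (edges s) i))
             (cong (h i ℚ.*_) (sym (starRoot-+ (edges s) (suc (edges t)) i)))) ⟩
      ⟨ h ⊙ starRoot (edges (attach s t)) ⟩ ∎
      where
      open ℚ.≤-Reasoning
      open +-*-Solver

    -- The long path is cut at distance `edges s` from the root. Shifting its outer part to the root
    -- leaves two paths there, which are then replaced by `s` and by `t` with its joining edge.
    path≤branch : ∀ t {h} → Monotone _≼_ h → ⟨ h ⊙ walk (edges t) 𝟙 ⟩ ℚ.≤ ⟨ h ⊙ branch t ⟩
    path≤branch single       H = ℚ.≤-refl
    path≤branch (attach s t) {h} H = begin
      ⟨ h ⊙ walk (edges s ℕ.+ suc (edges t)) 𝟙 ⟩
        ≡⟨ ⟨⟩-cong (λ i → cong (h i ℚ.*_) (walk-+ (edges s) (suc (edges t)) 𝟙 i)) ⟩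
      ⟨ h ⊙ walk (edges s) path ⟩
        ≤⟨ walk-merge (edges s) H path-monotone ⟩
      ⟨ h ⊙ path ⊙ walk (edges s) 𝟙 ⟩
        ≡⟨ ⟨⟩-cong (λ i → ℚ.*-assoc (h i) (path i) (walk (edges s) 𝟙 i)) ⟨
      ⟨ (h ⊙ path) ⊙ walk (edges s) 𝟙 ⟩
        ≤⟨ path≤branch s (⊙-monotone H path-monotone) ⟩
      ⟨ (h ⊙ path) ⊙ branch s ⟩
        ≡⟨ ⟨⟩-cong (λ i → solve 3 (λ h p s → (h :* p) :* s := (h :* s) :* p) refl
             (h i) (path i) (branch s i)) ⟩
      ⟨ (h ⊙ branch s) ⊙ A ⊡ walk (edges t) 𝟙 ⟩
        -- The root moves to the far end of the joining edge. There the induction hypothesis for `t`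
        -- applies, with all of the `s` side as the new `h`; afterwards the root moves back.
        ≡⟨ self-adjoint (h ⊙ branch s) (walk (edges t) 𝟙) ⟩
      ⟨ walk (edges t) 𝟙 ⊙ A ⊡ (h ⊙ branch s) ⟩
        ≡⟨ ⟨⟩-cong (λ i → ℚ.*-comm (walk (edges t) 𝟙 i) ((A ⊡ (h ⊙ branch s)) i)) ⟩
      ⟨ (A ⊡ (h ⊙ branch s)) ⊙ walk (edges t) 𝟙 ⟩
        ≤⟨ path≤branch t (⊡-monotone (⊙-monotone H (branch-monotone s))) ⟩
      ⟨ (A ⊡ (h ⊙ branch s)) ⊙ branch t ⟩
        ≡⟨ ⟨⟩-cong (λ i → ℚ.*-comm ((A ⊡ (h ⊙ branch s)) i) (branch t i)) ⟩
      ⟨ branch t ⊙ A ⊡ (h ⊙ branch s) ⟩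
        ≡⟨ self-adjoint (h ⊙ branch s) (branch t) ⟨
      ⟨ (h ⊙ branch s) ⊙ A ⊡ branch t ⟩
        ≡⟨ ⟨⟩-cong (λ i → ℚ.*-assoc (h i) (branch s i) ((A ⊡ branch t) i)) ⟩
      ⟨ h ⊙ branch s ⊙ A ⊡ branch t ⟩ ∎
      where
      open ℚ.≤-Reasoning
      open +-*-Solver
      path = walk (suc (edges t)) 𝟙
      path-monotone = walk-monotone (suc (edges t)) 𝟙-monotone

-- Finite sums, indicators and sums over all maps.

-- The generality covers sums and products of rationals as well as edge counts.
module SumAt (M : CommutativeMonoid 0ℓ 0ℓ) where
  open CommutativeMonoid M renaming (ε to 0#; sym to ≈-sym; trans to ≈-trans)
  open MonoidSum M using (sum-remove; sum-cong-≋; sum-replicate-zero) renaming (sum to ⨁)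

  sum-single : ∀ (t : Fin n → Carrier) j → (∀ i → i ≢ j → t i ≈ 0#) → ⨁ t ≈ t j
  sum-single {suc n} t j t≈0 = ≈-trans (sum-remove {i = j} t)
    (≈-trans
      (∙-congˡ (≈-trans (sum-cong-≋ λ i → t≈0 (punchIn j i) (Fin.punchInᵢ≢i j i))
                        (sum-replicate-zero n)))
      (identityʳ (t j)))

  sum-update : ∀ {s t : Fin n → Carrier} {c} u → t u ≈ s u ∙ c →
               (∀ i → i ≢ u → t i ≈ s i) → ⨁ t ≈ ⨁ s ∙ c
  sum-update {suc n} {s} {t} {c} u tu≈ t≈s = ≈-trans (sum-remove {i = u} t)
    (≈-trans (∙-cong tu≈ (sum-cong-≋ λ i → t≈s (punchIn u i) (Fin.punchInᵢ≢i u i)))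
      (≈-trans (assoc _ _ _) (≈-trans (∙-congˡ (comm _ _))
        (≈-trans (≈-sym (assoc _ _ _)) (∙-congʳ (≈-sym (sum-remove {i = u} s)))))))

open SumAt ℚ.+-0-commutativeMonoid using (sum-single)
open SumAt ℚ.*-1-commutativeMonoid using ()
  renaming (sum-single to product-single; sum-update to product-update)

indicator : ∀ {P : Set} → Dec P → ℚ
indicator P? = if does P? then 1ℚ else 0ℚ

indicator-nonNeg : ∀ {P : Set} (P? : Dec P) → 0ℚ ℚ.≤ indicator P?
indicator-nonNeg (yes _) = ℚ.nonNegative⁻¹ 1ℚ
indicator-nonNeg (no _)  = ℚ.≤-refl

indicator-mono : ∀ {P Q : Set} (P? : Dec P) (Q? : Dec Q) → (P → Q) → indicator P? ℚ.≤ indicator Q?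
indicator-mono (yes p) (yes _) _   = ℚ.≤-refl
indicator-mono (yes p) (no ¬q) P→Q = contradiction (P→Q p) ¬q
indicator-mono (no _)  Q?      _   = indicator-nonNeg Q?

indicator-cong : ∀ {P Q : Set} (P? : Dec P) (Q? : Dec Q) → (P → Q) → (Q → P) →
                 indicator P? ≡ indicator Q?
indicator-cong P? Q? P→Q Q→P = ℚ.≤-antisym (indicator-mono P? Q? P→Q) (indicator-mono Q? P? Q→P)

indicator-true : ∀ {P : Set} (P? : Dec P) → P → indicator P? ≡ 1ℚ
indicator-true P? p = cong (if_then 1ℚ else 0ℚ) (dec-true P? p)

indicator-false : ∀ {P : Set} (P? : Dec P) → ¬ P → indicator P? ≡ 0ℚ
indicator-false P? ¬p = cong (if_then 1ℚ else 0ℚ) (dec-false P? ¬p)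

indicator-× : ∀ {P Q : Set} (P? : Dec P) (Q? : Dec Q) →
              indicator (P? ×-dec Q?) ≡ indicator P? ℚ.* indicator Q?
indicator-× (yes _) (yes _) = refl
indicator-× (yes _) (no _)  = refl
indicator-× (no _)  (yes _) = refl
indicator-× (no _)  (no _)  = refl

-- An iterated sum over coordinates replaces the list of all maps, so that the colour of a single
-- vertex can be summed out.
sumMaps : ∀ n → (Vec (Fin q) n → ℚ) → ℚ
sumMaps zero    F = F []
sumMaps (suc n) F = sum λ i → sumMaps n λ σ → F (i ∷ σ)

sumMaps-cong : ∀ n {F G : Vec (Fin q) n → ℚ} → F ≗ G → sumMaps n F ≡ sumMaps n G
sumMaps-cong zero    F≗G = F≗G []
sumMaps-cong (suc n) F≗G = sum-cong-≗ λ i → sumMaps-cong n λ σ → F≗G (i ∷ σ)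

sumMaps-sum : ∀ n {m} (F : Fin m → Vec (Fin q) n → ℚ) →
              sum (λ i → sumMaps n (F i)) ≡ sumMaps n λ σ → sum λ i → F i σ
sumMaps-sum zero    F = refl
sumMaps-sum (suc n) F = trans
  (∑-comm λ i j → sumMaps n λ σ → F i (j ∷ σ))
  (sum-cong-≗ λ j → sumMaps-sum n λ i σ → F i (j ∷ σ))

-- Exchanging sums repeatedly brings the summation over coordinate `v` to the outside.
sumMaps-insertAt : ∀ n (F : Vec (Fin q) (suc n) → ℚ) v →
                   sumMaps (suc n) F ≡ sum λ i → sumMaps n λ σ → F (insertAt σ v i)
sumMaps-insertAt n       F zero    = refl
sumMaps-insertAt (suc n) F (suc v) = trans
  (sum-cong-≗ λ j → sumMaps-insertAt n (λ σ → F (j ∷ σ)) v)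
  (∑-comm λ j i → sumMaps n λ σ → F (j ∷ insertAt σ v i))

sumList : ∀ {A : Set} → (A → ℚ) → List A → ℚ
sumList f xs = List.foldr ℚ._+_ 0ℚ (List.map f xs)

sumList-++ : ∀ {A : Set} (f : A → ℚ) xs ys → sumList f (xs List.++ ys) ≡ sumList f xs ℚ.+ sumList f ys
sumList-++ f []       ys = sym (ℚ.+-identityˡ (sumList f ys))
sumList-++ f (x ∷ xs) ys = trans (cong (f x ℚ.+_) (sumList-++ f xs ys))
  (sym (ℚ.+-assoc (f x) (sumList f xs) (sumList f ys)))

sumList-filter : ∀ {A : Set} {P : Pred A 0ℓ} (P? : Decidable P) (f : A → ℚ) xs →
                 sumList f (List.filter P? xs) ≡ sumList (λ x → indicator (P? x) ℚ.* f x) xs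
sumList-filter P? f []       = refl
sumList-filter P? f (x ∷ xs) with P? x
... | yes _ = cong₂ ℚ._+_ (sym (ℚ.*-identityˡ (f x))) (sumList-filter P? f xs)
... | no _  = trans (sumList-filter P? f xs)
  (sym (trans (cong (ℚ._+ rest) (ℚ.*-zeroˡ (f x))) (ℚ.+-identityˡ rest)))
  where rest = sumList (λ x → indicator (P? x) ℚ.* f x) xs

sumList-cartesianProductWith : ∀ {A B C : Set} (_∙_ : A → B → C) (f : C → ℚ) {m} (g : Fin m → A) ys →
  sumList f (List.cartesianProductWith _∙_ (List.tabulate g) ys) ≡ sum λ i → sumList (λ y → f (g i ∙ y)) ys
sumList-cartesianProductWith _∙_ f {zero}  g ys = refl
sumList-cartesianProductWith _∙_ f {suc m} g ys = trans
  (sumList-++ f (List.map (g zero ∙_) ys) _)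
  (cong₂ ℚ._+_ (cong (List.foldr ℚ._+_ 0ℚ) (sym (map-∘ ys)))
             (sumList-cartesianProductWith _∙_ f (g ∘ suc) ys))

sumList-allMaps : ∀ n (F : Vec (Fin q) n → ℚ) → sumList F (allMaps n q) ≡ sumMaps n F
sumList-allMaps zero    F = ℚ.+-identityʳ (F [])
sumList-allMaps {q} (suc n) F = trans
  (sumList-cartesianProductWith _∷_ F (λ i → i) (allMaps n q))
  (sum-cong-≗ λ i → sumList-allMaps n λ σ → F (i ∷ σ))

-- Regroups the weight from colours to vertices: a further vertex of colour `j` raises only the
-- exponent at `j`, contributing one factor `a j`.
weightℚ-∏ : ∀ (a : Fin q → ℚ) (σ : Vec (Fin q) n) → weightℚ a σ ≡ product (λ v → a (lookup σ v))
weightℚ-∏ {q} a []      = product-1 q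
weightℚ-∏ {q} a (j ∷ σ) = begin
  product (λ i → a i ↑ Vec.count (i Fin.≟_) (j ∷ σ))
    ≡⟨ product-cong factor ⟩
  product (λ i → delta i ℚ.* a i ↑ Vec.count (i Fin.≟_) σ)
    ≡⟨ product-distrib-* delta (λ i → a i ↑ Vec.count (i Fin.≟_) σ) ⟩
  product delta ℚ.* weightℚ a σ
    ≡⟨ cong₂ ℚ._*_
         (product-single delta j λ i i≢j → cong (if_then a i else 1ℚ) (dec-false (i Fin.≟ j) i≢j))
         (weightℚ-∏ a σ) ⟩
  delta j ℚ.* product (λ v → a (lookup σ v))
    ≡⟨ cong (λ b → (if b then a j else 1ℚ) ℚ.* product (λ v → a (lookup σ v)))
         (dec-true (j Fin.≟ j) refl) ⟩
  a j ℚ.* product (λ v → a (lookup σ v)) ∎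
  where
  open ≡-Reasoning
  delta : Fin q → ℚ
  delta i = if does (i Fin.≟ j) then a i else 1ℚ
  factor : ∀ i → a i ↑ Vec.count (i Fin.≟_) (j ∷ σ) ≡ delta i ℚ.* a i ↑ Vec.count (i Fin.≟_) σ
  factor i with i Fin.≟ j
  ... | yes _ = refl
  ... | no _  = sym (ℚ.*-identityˡ _)

-- Removing a leaf from a partition function.

-- A relation between two given graphs, so that `G′` may come with its own description of adjacency,
-- as shorter paths and smaller stars do. Its vertices are those of `G` other than `v`, renumbered
-- by `punchIn v`.
record IsLeafRemoval (G : SimpleGraph (suc n)) (v : Fin (suc n))
                     (G′ : SimpleGraph n) (u : Fin n) : Set where
  private
    module G  = SimpleGraph G
    module G′ = SimpleGraph G′
  field
    attached : G.Adj v (punchIn v u)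
    pendant  : ∀ x → G.Adj v (punchIn v x) → x ≡ u
    extend   : ∀ {x y} → G′.Adj x y → G.Adj (punchIn v x) (punchIn v y)
    restrict : ∀ {x y} → G.Adj (punchIn v x) (punchIn v y) → G′.Adj x y

data PunchView (v : Fin (suc n)) : Fin (suc n) → Set where
  here  : PunchView v v
  there : ∀ x → PunchView v (punchIn v x)

punchView : ∀ (v x : Fin (suc n)) → PunchView v x
punchView v x with v Fin.≟ x
... | yes refl = here
... | no v≢x   = subst (PunchView v) (Fin.punchIn-punchOut v≢x) (there (punchOut v≢x))

module Colourings (H : Graph q) where
  private module H = Graph H

  A : Fin q → Fin q → ℚ
  A i j = indicator (H.adj? i j)

  -- The weight may vary with the vertex, so that a removed leaf can be recorded at its neighbour.
  partition : SimpleGraph n → (Fin n → Fin q → ℚ) → ℚ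
  partition {n} G w = sumMaps n λ σ →
    indicator (isColouring? G H σ) ℚ.* product λ v → w v (lookup σ v)

  partition-cong : ∀ (G : SimpleGraph n) w w′ → (∀ v → w v ≗ w′ v) → partition G w ≡ partition G w′
  partition-cong {n} G w w′ w≗w′ = sumMaps-cong n λ σ →
    cong (indicator (isColouring? G H σ) ℚ.*_) (product-cong λ v → w≗w′ v (lookup σ v))

  Zℚ-partition : ∀ (a : Fin q → ℚ) (G : SimpleGraph n) → Zℚ a G H ≡ partition G (λ _ → a)
  Zℚ-partition {n} a G = begin
    Zℚ a G H
      ≡⟨ sumList-filter (isColouring? G H) (weightℚ a) (allMaps n q) ⟩
    sumList (λ σ → indicator (isColouring? G H σ) ℚ.* weightℚ a σ) (allMaps n q)
      ≡⟨ sumList-allMaps n _ ⟩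
    sumMaps n (λ σ → indicator (isColouring? G H σ) ℚ.* weightℚ a σ)
      ≡⟨ sumMaps-cong n (λ σ → cong (indicator (isColouring? G H σ) ℚ.*_) (weightℚ-∏ a σ)) ⟩
    partition G (λ _ → a) ∎
    where open ≡-Reasoning

  module _ {G : SimpleGraph (suc n)} {v G′ u} (leaf : IsLeafRemoval G v G′ u) where
    open IsLeafRemoval leaf
    private
      module G  = SimpleGraph G
      module G′ = SimpleGraph G′

    isColouring-insertAt⁻ : ∀ σ i → IsColouring G H (insertAt σ v i) →
                            IsColouring G′ H σ × H.Adj (lookup σ u) i
    isColouring-insertAt⁻ σ i col =
      (λ x y x~y → subst₂ H.Adj (insertAt-punchIn σ v i x) (insertAt-punchIn σ v i y)
        (col _ _ (extend x~y))) ,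
      H.adj-sym (subst₂ H.Adj (insertAt-lookup σ v i) (insertAt-punchIn σ v i u) (col _ _ attached))

    isColouring-insertAt⁺ : ∀ σ i → IsColouring G′ H σ × H.Adj (lookup σ u) i →
                            IsColouring G H (insertAt σ v i)
    isColouring-insertAt⁺ σ i (col , u~i) x y x~y with punchView v x | punchView v y
    ... | here    | here    = contradiction x~y (G.loopless refl)
    ... | here    | there y rewrite pendant y x~y =
      subst₂ H.Adj (sym (insertAt-lookup σ v i)) (sym (insertAt-punchIn σ v i u)) (H.adj-sym u~i)
    ... | there x | here    rewrite pendant x (G.adj-sym x~y) =
      subst₂ H.Adj (sym (insertAt-punchIn σ v i u)) (sym (insertAt-lookup σ v i)) u~i
    ... | there x | there y =
      subst₂ H.Adj (sym (insertAt-punchIn σ v i x)) (sym (insertAt-punchIn σ v i y))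
        (col x y (restrict x~y))

    module _ (a : Fin q → ℚ) where
      open Weighted a

      -- The only edge at `v` leads to `u`. Summing out the colour of `v` therefore yields a factor
      -- depending on the colour of `u` alone, namely `A ⊡ f v`.
      partition-leafRemoval : (f : Fin (suc n) → Fin q → ℚ) (f′ : Fin n → Fin q → ℚ) →
        f′ u ≗ f (punchIn v u) ⊙ A ⊡ f v →
        (∀ x → x ≢ u → f′ x ≗ f (punchIn v x)) →
        partition G (λ x → a ⊙ f x) ≡ partition G′ (λ x → a ⊙ f′ x)
      partition-leafRemoval f f′ f′u f′x = begin
        partition G (λ x → a ⊙ f x)
          ≡⟨ sumMaps-insertAt n (λ σ →
               indicator (isColouring? G H σ) ℚ.* product λ x → (a ⊙ f x) (lookup σ x)) v ⟩
        sum (λ i → sumMaps n λ σ → indicator (isColouring? G H (insertAt σ v i)) ℚ.*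
              product (λ x → (a ⊙ f x) (lookup (insertAt σ v i) x)))
          ≡⟨ sum-cong-≗ (λ i → sumMaps-cong n λ σ →
               cong₂ ℚ._*_ (leafIndicator i σ) (leafProduct i σ)) ⟩
        sum (λ i → sumMaps n λ σ → (col σ ℚ.* A (lookup σ u) i) ℚ.* ((a i ℚ.* f v i) ℚ.* rest σ))
          ≡⟨ sumMaps-sum n (λ i σ → (col σ ℚ.* A (lookup σ u) i) ℚ.* ((a i ℚ.* f v i) ℚ.* rest σ)) ⟩
        sumMaps n (λ σ → sum λ i → (col σ ℚ.* A (lookup σ u) i) ℚ.* ((a i ℚ.* f v i) ℚ.* rest σ))
          ≡⟨ sumMaps-cong n (λ σ → sum-cong-≗ λ i →
               regroup (col σ) (A (lookup σ u) i) (a i ℚ.* f v i) (rest σ)) ⟩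
        sumMaps n (λ σ → sum λ i → (col σ ℚ.* rest σ) ℚ.* (A (lookup σ u) i ℚ.* (a i ℚ.* f v i)))
          ≡⟨ sumMaps-cong n (λ σ →
               *-distribˡ-sum (col σ ℚ.* rest σ) λ i → A (lookup σ u) i ℚ.* (a i ℚ.* f v i)) ⟨
        sumMaps n (λ σ → (col σ ℚ.* rest σ) ℚ.* (A ⊡ f v) (lookup σ u))
          -- The new factor is absorbed into the weight at `u`, the one place where `f′` differs
          -- from `f`.
          ≡⟨ sumMaps-cong n (λ σ → trans (ℚ.*-assoc (col σ) (rest σ) _)
               (cong (col σ ℚ.*_) (sym (product-update u (updated σ) (unchanged σ))))) ⟩
        partition G′ (λ x → a ⊙ f′ x) ∎
        where
        open ≡-Reasoning
        col rest : Vec (Fin q) n → ℚ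
        col σ = indicator (isColouring? G′ H σ)
        rest σ = product λ x → (a ⊙ f (punchIn v x)) (lookup σ x)
        leafIndicator : ∀ i σ →
          indicator (isColouring? G H (insertAt σ v i)) ≡ col σ ℚ.* A (lookup σ u) i
        leafIndicator i σ = trans
          (indicator-cong (isColouring? G H (insertAt σ v i))
            (isColouring? G′ H σ ×-dec H.adj? (lookup σ u) i)
            (isColouring-insertAt⁻ σ i) (isColouring-insertAt⁺ σ i))
          (indicator-× (isColouring? G′ H σ) (H.adj? (lookup σ u) i))
        leafProduct : ∀ i σ →
          product (λ x → (a ⊙ f x) (lookup (insertAt σ v i) x)) ≡ (a i ℚ.* f v i) ℚ.* rest σ
        leafProduct i σ = trans
          (product-remove {i = v} (λ x → (a ⊙ f x) (lookup (insertAt σ v i) x)))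
          (cong₂ ℚ._*_ (cong (a ⊙ f v) (insertAt-lookup σ v i))
            (product-cong λ x → cong (a ⊙ f (punchIn v x)) (insertAt-punchIn σ v i x)))
        regroup : ∀ c b x r → (c ℚ.* b) ℚ.* (x ℚ.* r) ≡ (c ℚ.* r) ℚ.* (b ℚ.* x)
        regroup = solve 4 (λ c b x r → (c :* b) :* (x :* r) := (c :* r) :* (b :* x)) refl
          where open +-*-Solver
        updated : ∀ σ →
          (a ⊙ f′ u) (lookup σ u) ≡ (a ⊙ f (punchIn v u)) (lookup σ u) ℚ.* (A ⊡ f v) (lookup σ u)
        updated σ = trans (cong (a (lookup σ u) ℚ.*_) (f′u (lookup σ u)))
          (sym (ℚ.*-assoc (a (lookup σ u)) (f (punchIn v u) (lookup σ u)) _))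
        unchanged : ∀ σ x → x ≢ u → (a ⊙ f′ x) (lookup σ x) ≡ (a ⊙ f (punchIn v x)) (lookup σ x)
        unchanged σ x x≢u = cong (a (lookup σ x) ℚ.*_) (f′x x x≢u (lookup σ x))

-- Existence of leaves in trees.

unique-lookup-injective : {xs : List X} → Unique xs → Injective _≡_ _≡_ (List.lookup xs)
unique-lookup-injective (_    ∷ _)  {zero}  {zero}  _  = refl
unique-lookup-injective (x∉xs ∷ _)  {zero}  {suc j} eq =
  contradiction eq (All.lookup x∉xs (∈-lookup j))
unique-lookup-injective (x∉xs ∷ _)  {suc i} {zero}  eq =
  contradiction (sym eq) (All.lookup x∉xs (∈-lookup i))
unique-lookup-injective (_    ∷ uxs) {suc i} {suc j} eq = cong suc (unique-lookup-injective uxs eq)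

-- The pigeonhole principle; it bounds the search for a maximal path.
unique-length : {xs : List (Fin n)} → Unique xs → length xs ℕ.≤ n
unique-length uxs = Fin.injective⇒≤ (unique-lookup-injective uxs)

linked-++⁻ˡ : {R : Rel X 0ℓ} → ∀ xs {ys} → Linked R (xs ++ ys) → Linked R xs
linked-++⁻ˡ []           _           = []
linked-++⁻ˡ (x ∷ [])     _           = [-]
linked-++⁻ˡ (x ∷ y ∷ xs) (Rxy ∷ Rxs) = Rxy ∷ linked-++⁻ˡ (y ∷ xs) Rxs

-- Used to close a cycle: the repeated vertex `z` becomes its starting point and the part of the
-- path beyond `z` is dropped.
unique-rotate : ∀ (xs : List X) {z ys} → Unique (xs ++ z ∷ ys) → Unique (z ∷ xs)
unique-rotate []       _         = [] ∷ []
unique-rotate (x ∷ xs) (x∉ ∷ uxs) with unique-rotate xs uxs | All.++⁻ xs x∉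
... | z∉xs ∷ u | x∉xs , x≢z ∷ _ = ((λ z≡x → x≢z (sym z≡x)) ∷ z∉xs) ∷ (x∉xs ∷ u)

HasLeaf : SimpleGraph (suc n) → Set
HasLeaf G = ∃₂ λ v u → Adj v (punchIn v u) × (∀ x → Adj v (punchIn v x) → x ≡ u)
  where open SimpleGraph G

-- A maximal path ends in a leaf: any further neighbour of its end x would
-- close a cycle.
acyclic⇒leaf : ∀ (G : SimpleGraph (suc n)) → Acyclic G →
               ∀ fuel x y vs → suc (suc n) ℕ.≤ fuel ℕ.+ length (x ∷ y ∷ vs) →
               Unique (x ∷ y ∷ vs) → Linked (SimpleGraph.Adj G) (x ∷ y ∷ vs) → HasLeaf G
acyclic⇒leaf G acyclic zero       x y vs long unique linked =
  -- Without fuel the path would have at least `n + 2` distinct vertices among `n + 1`.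
  contradiction (ℕ.≤-trans long (unique-length unique)) ℕ.1+n≰n
acyclic⇒leaf {n} G acyclic (suc fuel) x y vs long unique linked@(x~y ∷ _)
  with Fin.any? (λ z → SimpleGraph.adj? G x z ×-dec ¬? (z Fin.≟ y))
... | no noOther = x , punchOut x≢y , subst (Adj x) (sym (Fin.punchIn-punchOut x≢y)) x~y ,
      λ w x~w → Fin.punchIn-injective x w (punchOut x≢y) (trans
        (decidable-stable (punchIn x w Fin.≟ y) λ w≢y → noOther (punchIn x w , x~w , w≢y))
        (sym (Fin.punchIn-punchOut x≢y)))
  where
  open SimpleGraph G
  x≢y : x ≢ y
  x≢y x≡y = loopless x≡y x~y
... | yes (z , x~z , z≢y) with any? (z Fin.≟_) vs
...   | no z∉vs = acyclic⇒leaf G acyclic fuel z x (y ∷ vs)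
        (subst (suc (suc n) ℕ.≤_) (sym (ℕ.+-suc fuel _)) long)
        (((λ z≡x → loopless (sym z≡x) x~z) ∷ z≢y ∷ All.¬Any⇒All¬ vs z∉vs) ∷ unique)
        (adj-sym x~z ∷ linked)
  where open SimpleGraph G
...   | yes z∈vs with ∈-∃++ z∈vs
-- The stretch from `x` through `y` and `us` to `z`, together with the edge between `z` and `x`, is
-- a cycle.
...     | us , ws , refl = contradiction
          (adj-sym x~z ∷ linked-++⁻ˡ (x ∷ y ∷ us ∷ʳ z)
            (subst (Linked Adj) (sym (++-assoc (x ∷ y ∷ us) (z ∷ []) ws)) linked))
          (acyclic z x y us (unique-rotate (x ∷ y ∷ us) unique))
  where open SimpleGraph G

tree⇒leaf : ∀ (G : SimpleGraph (suc (suc n))) → IsTree G → HasLeaf G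
-- A walk between two different vertices is nonempty, and its first edge starts the search. Fuel
-- `suc n` plus the two vertices of that edge is one more than the number of vertices.
tree⇒leaf {n} G (_ , connected , acyclic) with connected zero (suc zero)
... | _◅_ {j = y} 0~y _ = acyclic⇒leaf G acyclic (suc n) zero y []
  (ℕ.≤-reflexive (sym (trans (ℕ.+-comm (suc n) 2) refl)))
  (((λ 0≡y → SimpleGraph.loopless G 0≡y 0~y) ∷ []) ∷ [] ∷ []) (0~y ∷ [-])

-- Deleting a leaf of a tree leaves a tree.

deleteVertex : SimpleGraph (suc n) → Fin (suc n) → SimpleGraph n
deleteVertex G v = record
  { graph = record
    { Adj     = λ x y → Adj (punchIn v x) (punchIn v y)
    ; adj?    = λ x y → adj? (punchIn v x) (punchIn v y)
    ; adj-sym = adj-sym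
    }
  ; loopless = λ x≡y → loopless (cong (punchIn v) x≡y)
  }
  where open SimpleGraph G

module _ (G : SimpleGraph (suc n)) {v u} (attached : SimpleGraph.Adj G v (punchIn v u))
         (pendant : ∀ x → SimpleGraph.Adj G v (punchIn v x) → x ≡ u) where
  open SimpleGraph G
  private module G′ = SimpleGraph (deleteVertex G v)

  deleteVertex-isLeafRemoval : IsLeafRemoval G v (deleteVertex G v) u
  deleteVertex-isLeafRemoval = record
    { attached = attached
    ; pendant  = pendant
    ; extend   = λ x~y → x~y
    ; restrict = λ x~y → x~y
    }

  private
    -- Walks survive the deletion of v because v can be folded onto its
    -- only neighbour.
    fold : ∀ {x} → PunchView v x → Fin n
    fold here      = u
    fold (there x) = x

    fold-walk : ∀ {x y} (p : PunchView v x) (q : PunchView v y) →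
                Star Adj x y → Star G′.Adj (fold p) (fold q)
    fold-walk p q ε = subst (Star G′.Adj (fold p)) (fold-irrelevant p q) ε
      where
      fold-unique : ∀ {x y} (p : PunchView v x) (q : PunchView v y) → x ≡ y → fold p ≡ fold q
      fold-unique here      here      _  = refl
      fold-unique here      (there y) eq = contradiction (sym eq) (Fin.punchInᵢ≢i v y)
      fold-unique (there x) here      eq = contradiction eq (Fin.punchInᵢ≢i v x)
      fold-unique (there x) (there y) eq = Fin.punchIn-injective v x y eq
      fold-irrelevant : ∀ {x} (p q : PunchView v x) → fold p ≡ fold q
      fold-irrelevant p q = fold-unique p q refl
    fold-walk p q (_◅_ {j = y} x~y walk) =
      fold-step p (punchView v y) x~y ◅◅ fold-walk (punchView v y) q walk
      where
      fold-step : ∀ {x y} (p : PunchView v x) (q : PunchView v y) →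
                  Adj x y → Star G′.Adj (fold p) (fold q)
      fold-step here      here      v~v = contradiction v~v (loopless refl)
      fold-step here      (there y) v~y = subst (λ w → Star G′.Adj w y) (pendant y v~y) ε
      fold-step (there x) here      x~v = subst (Star G′.Adj x) (pendant x (adj-sym x~v)) ε
      fold-step (there x) (there y) x~y = x~y ◅ ε

  deleteVertex-connected : Connected G → Connected (deleteVertex G v)
  deleteVertex-connected connected x y =
    fold-walk (there x) (there y) (connected (punchIn v x) (punchIn v y))

deleteVertex-acyclic : ∀ (G : SimpleGraph (suc n)) v → Acyclic G → Acyclic (deleteVertex G v)
deleteVertex-acyclic G v acyclic x y z vs unique linked = acyclic _ _ _ (List.map (punchIn v) vs)
  (Unique.map⁺ (Fin.punchIn-injective v _ _) unique)
  (subst (Linked (SimpleGraph.Adj G)) (map-++ (punchIn v) (x ∷ y ∷ z ∷ vs) (x ∷ []))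
    (Linked.map⁺ linked))

-- Partition functions of paths, stars and trees in rooted form.

open SumAt ℕ.+-0-commutativeMonoid using () renaming (sum-update to sumℕ-update)

path-leafRemoval : ∀ n → IsLeafRemoval (pathGraph (suc (suc n))) zero (pathGraph (suc n)) zero
path-leafRemoval n = record
  { attached = inj₁ refl
  ; pendant  = λ where x (inj₁ eq) → Fin.toℕ-injective (ℕ.suc-injective eq)
  ; extend   = Sum.map (cong suc) (cong suc)
  ; restrict = Sum.map ℕ.suc-injective ℕ.suc-injective
  }

-- The vertex after the centre is removed, so the centre keeps the number 0.
star-leafRemoval : ∀ n → IsLeafRemoval (starGraph (suc (suc n))) (suc zero) (starGraph (suc n)) zero
star-leafRemoval n = record
  { attached = (λ ()) , inj₂ refl
  ; pendant  = λ where
      zero    _             → refl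
      (suc x) (_ , inj₁ ())
      (suc x) (_ , inj₂ ())
  ; extend   = λ {x} {y} (x≢y , centre) →
      (λ eq → x≢y (Fin.punchIn-injective (suc zero) x y eq)) , Sum.map (centre⁺ x) (centre⁺ y) centre
  ; restrict = λ {x} {y} (x≢y , centre) →
      (λ eq → x≢y (cong (punchIn (suc zero)) eq)) , Sum.map (centre⁻ x) (centre⁻ y) centre
  }
  where
  centre⁺ : ∀ (x : Fin (suc n)) → toℕ x ≡ 0 → toℕ (punchIn (suc zero) x) ≡ 0
  centre⁺ zero    _ = refl
  centre⁻ : ∀ (x : Fin (suc n)) → toℕ (punchIn (suc zero) x) ≡ 0 → toℕ x ≡ 0
  centre⁻ zero    _ = refl

module TreePartition (H : Graph q) (a : Fin q → ℚ) where
  open Colourings H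
  open Weighted a
  open RootedPartition A a

  A-sym : ∀ i j → A i j ≡ A j i
  A-sym i j =
    indicator-cong (Graph.adj? H i j) (Graph.adj? H j i) (Graph.adj-sym H) (Graph.adj-sym H)

  partition-single : ∀ (G : SimpleGraph 1) (f : Fin 1 → Fin q → ℚ) →
                     partition G (λ x → a ⊙ f x) ≡ ⟨ f zero ⟩
  partition-single G f = sum-cong-≗ λ i → trans
    (cong (ℚ._* ((a ⊙ f zero) i ℚ.* 1ℚ)) (indicator-true (isColouring? G H (i ∷ []))
      λ { zero zero z~z → contradiction z~z (SimpleGraph.loopless G refl) }))
    (trans (ℚ.*-identityˡ _) (ℚ.*-identityʳ _))

  -- The invariant while leaves are peeled off: everything removed so far is recorded in `h` at
  -- vertex 0.
  rootedAt-0 : (Fin q → ℚ) → Fin (suc n) → Fin q → ℚ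
  rootedAt-0 h zero    = h
  rootedAt-0 h (suc _) = 𝟙

  -- Vertex 0 itself is the leaf removed, so `h` is carried to the next vertex as `A ⊡ h`;
  -- self-adjointness hands the operator back to the walk.
  path-partition : ∀ m h →
    partition (pathGraph (suc m)) (λ x → a ⊙ rootedAt-0 h x) ≡ ⟨ h ⊙ walk m 𝟙 ⟩
  path-partition zero    h = trans (partition-single (pathGraph 1) (rootedAt-0 h))
    (⟨⟩-cong λ i → sym (ℚ.*-identityʳ (h i)))
  path-partition (suc m) h = begin
    partition (pathGraph (suc (suc m))) (λ x → a ⊙ rootedAt-0 h x)
      ≡⟨ partition-leafRemoval (path-leafRemoval m) a (rootedAt-0 h) (rootedAt-0 (A ⊡ h))
           (λ i → sym (ℚ.*-identityˡ ((A ⊡ h) i)))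
           (λ { zero 0≢0 → contradiction refl 0≢0 ; (suc x) _ i → refl }) ⟩
    partition (pathGraph (suc m)) (λ x → a ⊙ rootedAt-0 (A ⊡ h) x)
      ≡⟨ path-partition m (A ⊡ h) ⟩
    ⟨ (A ⊡ h) ⊙ walk m 𝟙 ⟩
      ≡⟨ ⟨⟩-cong (λ i → ℚ.*-comm ((A ⊡ h) i) (walk m 𝟙 i)) ⟩
    ⟨ walk m 𝟙 ⊙ A ⊡ h ⟩
      ≡⟨ Symmetric.self-adjoint A-sym (walk m 𝟙) h ⟩
    ⟨ h ⊙ walk (suc m) 𝟙 ⟩ ∎
    where open ≡-Reasoning

  star-partition : ∀ m h →
    partition (starGraph (suc m)) (λ x → a ⊙ rootedAt-0 h x) ≡ ⟨ h ⊙ starRoot m ⟩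
  star-partition zero    h = trans (partition-single (starGraph 1) (rootedAt-0 h))
    (⟨⟩-cong λ i → sym (ℚ.*-identityʳ (h i)))
  star-partition (suc m) h = begin
    partition (starGraph (suc (suc m))) (λ x → a ⊙ rootedAt-0 h x)
      ≡⟨ partition-leafRemoval (star-leafRemoval m) a (rootedAt-0 h) (rootedAt-0 (h ⊙ A ⊡ 𝟙))
           (λ i → refl)
           (λ { zero 0≢0 → contradiction refl 0≢0 ; (suc x) _ i → refl }) ⟩
    partition (starGraph (suc m)) (λ x → a ⊙ rootedAt-0 (h ⊙ A ⊡ 𝟙) x)
      ≡⟨ star-partition m (h ⊙ A ⊡ 𝟙) ⟩
    ⟨ (h ⊙ A ⊡ 𝟙) ⊙ starRoot m ⟩
      ≡⟨ ⟨⟩-cong (λ i → ℚ.*-assoc (h i) ((A ⊡ 𝟙) i) (starRoot m i)) ⟩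
    ⟨ h ⊙ starRoot (suc m) ⟩ ∎
    where open ≡-Reasoning

  -- Each vertex carries the rooted tree of what has been folded into it. Removing a leaf attaches
  -- its tree to that of its neighbour, which turns one edge of `T` into an edge of the carried
  -- trees.
  tree-partition : ∀ (T : SimpleGraph (suc n)) → IsTree T → (t : Fin (suc n) → RootedTree) →
    ∃ λ s → edges s ≡ n ℕ.+ sumℕ (edges ∘ t) × partition T (λ x → a ⊙ branch (t x)) ≡ ⟨ branch s ⟩
  tree-partition {zero}  T _ t = t zero , sym (ℕ.+-identityʳ _) , partition-single T (branch ∘ t)
  tree-partition {suc n} T isTree@(_ , connected , acyclic) t
    with tree⇒leaf T isTree
  ... | v , u , attached , pendant
    with tree-partition (deleteVertex T v)
           (ℕ.s≤s ℕ.z≤n , deleteVertex-connected T attached pendant connected ,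
            deleteVertex-acyclic T v acyclic)
           (updateAt (t ∘ punchIn v) u (λ r → attach r (t v)))
  ... | s , edges≡ , partition≡ = s , trans edges≡ size , trans leaf partition≡
    where
    open ≡-Reasoning
    grow : RootedTree → RootedTree
    grow r = attach r (t v)
    t′ = updateAt (t ∘ punchIn v) u grow
    leaf : partition T (λ x → a ⊙ branch (t x)) ≡
           partition (deleteVertex T v) (λ x → a ⊙ branch (t′ x))
    leaf = partition-leafRemoval (deleteVertex-isLeafRemoval T attached pendant) a
      (branch ∘ t) (branch ∘ t′)
      (λ i → cong (λ s → branch s i) (updateAt-updates u {grow} (t ∘ punchIn v)))
      (λ x x≢u i → cong (λ s → branch s i) (updateAt-minimal x u {grow} (t ∘ punchIn v) x≢u))
    size : n ℕ.+ sumℕ (edges ∘ t′) ≡ suc n ℕ.+ sumℕ (edges ∘ t)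
    size = begin
      n ℕ.+ sumℕ (edges ∘ t′)
        ≡⟨ cong (n ℕ.+_) (sumℕ-update {s = edges ∘ t ∘ punchIn v} u
             (cong edges (updateAt-updates u {grow} (t ∘ punchIn v)))
             (λ x x≢u → cong edges (updateAt-minimal x u {grow} (t ∘ punchIn v) x≢u))) ⟩
      n ℕ.+ (rest ℕ.+ suc (edges (t v)))
        ≡⟨ solve 3 (λ n r e → n :+ (r :+ (con 1 :+ e)) := con 1 :+ n :+ (e :+ r)) refl
             n rest (edges (t v)) ⟩
      suc n ℕ.+ (edges (t v) ℕ.+ rest)
        ≡⟨ cong (suc n ℕ.+_) (sumℕ-remove {i = v} (edges ∘ t)) ⟨
      suc n ℕ.+ sumℕ (edges ∘ t) ∎
      where
      open ℕ-Solver
      rest = sumℕ (edges ∘ t ∘ punchIn v)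

  module _ {_≼_ : Rel (Fin q) 0ℓ} (model : IsOrderedModel A a _≼_) where
    open Bounds model

    path≤tree≤star : ∀ (T : SimpleGraph (suc n)) → IsTree T →
      Zℚ a (pathGraph (suc n)) H ℚ.≤ Zℚ a T H × Zℚ a T H ℚ.≤ Zℚ a (starGraph (suc n)) H
    path≤tree≤star {n} T isTree with tree-partition T isTree (λ _ → single)
    ... | s , edges≡ , partition≡ =
      subst₂ ℚ._≤_ (sym Z-path) (sym Z-tree) (path≤branch s 𝟙-monotone) ,
      subst₂ ℚ._≤_ (sym Z-tree) (sym Z-star) (branch≤star s 𝟙-monotone)
      where
      size : edges s ≡ n
      size = trans edges≡ (trans (cong (n ℕ.+_) (sumℕ-zero (suc n))) (ℕ.+-identityʳ n))
      Z-rooted : ∀ (G : SimpleGraph (suc n)) → Zℚ a G H ≡ partition G (λ x → a ⊙ rootedAt-0 𝟙 x)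
      Z-rooted G = trans (Zℚ-partition a G)
        (partition-cong G (λ _ → a) (λ x → a ⊙ rootedAt-0 𝟙 x) λ where
        zero    i → sym (ℚ.*-identityʳ (a i))
        (suc _) i → sym (ℚ.*-identityʳ (a i)))
      Z-path : Zℚ a (pathGraph (suc n)) H ≡ ⟨ 𝟙 ⊙ walk (edges s) 𝟙 ⟩
      Z-path = trans (Z-rooted (pathGraph (suc n)))
        (trans (path-partition n 𝟙) (cong (λ m → ⟨ 𝟙 ⊙ walk m 𝟙 ⟩) (sym size)))
      Z-star : Zℚ a (starGraph (suc n)) H ≡ ⟨ 𝟙 ⊙ starRoot (edges s) ⟩
      Z-star = trans (Z-rooted (starGraph (suc n)))
        (trans (star-partition n 𝟙) (cong (λ m → ⟨ 𝟙 ⊙ starRoot m ⟩) (sym size)))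
      Z-tree : Zℚ a T H ≡ ⟨ 𝟙 ⊙ branch s ⟩
      Z-tree = trans (Zℚ-partition a T) (trans
        (partition-cong T (λ _ → a) (λ _ → a ⊙ 𝟙) λ _ i → sym (ℚ.*-identityʳ (a i)))
        (trans partition≡ (⟨⟩-cong λ i → sym (ℚ.*-identityˡ (branch s i)))))

  module _ (a-nonNeg : ∀ i → 0ℚ ℚ.≤ a i) where

    -- If the neighbourhood of `i` lies in that of `j`, the inequality holds term by term, since `f`
    -- and the activities are nonnegative.
    nested-⊡-mono : ∀ {_≼_ : Rel (Fin q) 0ℓ} {f} → Monotone _≼_ f → ∀ {i j} →
      (∀ k → Graph.Adj H i k → Graph.Adj H j k) → (A ⊡ f) i ℚ.≤ (A ⊡ f) j
    nested-⊡-mono F {i} {j} nested = sum-mono λ k → *-monoʳ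
      (*-nonNeg (a-nonNeg k) (F .nonNeg k))
      (indicator-mono (Graph.adj? H i k) (Graph.adj? H j k) (nested k))

    orderedModel : ∀ {_≼_ : Rel (Fin q) 0ℓ} → Total _≼_ →
      (∀ {f} → Monotone _≼_ f → ∀ {i j} → i ≼ j → (A ⊡ f) i ℚ.≤ (A ⊡ f) j) → IsOrderedModel A a _≼_
    orderedModel total ⊡-mono = record
      { a-nonNeg = a-nonNeg
      ; A-nonNeg = λ i j → indicator-nonNeg (Graph.adj? H i j)
      ; A-sym    = A-sym
      ; total    = total
      ; ⊡-mono   = ⊡-mono
      }

-- The orders for the three models.

-- Colours are ordered downwards because a larger number means a smaller neighbourhood in both
-- `H-ind` and `H-cap`; monotone functions are largest at colour 0.
_≽_ : Rel (Fin q) 0ℓ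
i ≽ j = toℕ j ℕ.≤ toℕ i

≽-total : Total (_≽_ {q})
≽-total i j = ℕ.≤-total (toℕ j) (toℕ i)

ind-ordered : ∀ (a : Fin 2 → ℚ) → (∀ i → 0ℚ ℚ.≤ a i) → IsOrderedModel (Colourings.A H-ind) a _≽_
ind-ordered a a-nonNeg = orderedModel a-nonNeg ≽-total λ F i≽j →
  nested-⊡-mono a-nonNeg F (nested i≽j)
  where
  open TreePartition H-ind a
  nested : ∀ {i j : Fin 2} → i ≽ j → ∀ k → Graph.Adj H-ind i k → Graph.Adj H-ind j k
  nested {j = zero}              _   k _           = inj₁ refl
  nested {j = suc zero}          _   k (inj₂ k≡0)  = inj₂ k≡0
  nested {j = suc zero}          i≽j k (inj₁ refl) = contradiction i≽j λ ()

cap-ordered : ∀ C (a : Fin (suc C) → ℚ) → (∀ i → 0ℚ ℚ.≤ a i) →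
              IsOrderedModel (Colourings.A (H-cap C)) a _≽_
cap-ordered C a a-nonNeg = orderedModel a-nonNeg ≽-total λ F i≽j →
  nested-⊡-mono a-nonNeg F λ k i+k≤C → ℕ.≤-trans (ℕ.+-monoˡ-≤ (toℕ k) i≽j) i+k≤C
  where open TreePartition (H-cap C) a

-- The centre is on top. Distinct outer colours have incomparable neighbourhoods, so they are
-- compared by activity instead.
WR-order : ∀ {k} → (Fin (suc k) → ℚ) → Rel (Fin (suc k)) 0ℓ
WR-order a _       zero    = ⊤
WR-order a zero    (suc _) = ⊥
WR-order a (suc i) (suc j) = a (suc i) ℚ.≤ a (suc j)

WR-ordered : ∀ k (a : Fin (suc k) → ℚ) → (∀ i → 0ℚ ℚ.≤ a i) →
             IsOrderedModel (Colourings.A (H-WR k)) a (WR-order a)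
WR-ordered k a a-nonNeg = orderedModel a-nonNeg total ⊡-mono
  where
  open Colourings (H-WR k)
  open TreePartition (H-WR k) a
  open Weighted a
  total : Total (WR-order a)
  total _       zero    = inj₁ _
  total zero    (suc _) = inj₂ _
  total (suc i) (suc j) = ℚ.≤-total (a (suc i)) (a (suc j))
  A-off : ∀ {i j} → j ≢ i → A (suc i) (suc j) ≡ 0ℚ
  A-off {i} {j} j≢i = indicator-false (Graph.adj? (H-WR k) (suc i) (suc j)) λ where
    (inj₁ eq)        → j≢i (sym (Fin.suc-injective eq))
    (inj₂ (inj₁ ()))
    (inj₂ (inj₂ ()))
  -- An outer colour is adjacent only to the centre and to itself.
  ⊡-suc : ∀ f i → (A ⊡ f) (suc i) ≡ 1ℚ ℚ.* (a zero ℚ.* f zero) ℚ.+ a (suc i) ℚ.* f (suc i)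
  ⊡-suc f i = cong (1ℚ ℚ.* (a zero ℚ.* f zero) ℚ.+_) (trans
    (sum-single (λ j → A (suc i) (suc j) ℚ.* (a (suc j) ℚ.* f (suc j))) i λ j j≢i →
      trans (cong (ℚ._* (a (suc j) ℚ.* f (suc j))) (A-off j≢i))
        (ℚ.*-zeroˡ (a (suc j) ℚ.* f (suc j))))
    (trans (cong (ℚ._* (a (suc i) ℚ.* f (suc i)))
        (indicator-true (Graph.adj? (H-WR k) (suc i) (suc i)) (inj₁ refl)))
      (ℚ.*-identityˡ (a (suc i) ℚ.* f (suc i)))))
  ⊡-mono : ∀ {f} → Monotone (WR-order a) f → ∀ {i j} → WR-order a i j → (A ⊡ f) i ℚ.≤ (A ⊡ f) j
  ⊡-mono F {i}     {zero}  _ = nested-⊡-mono a-nonNeg F {i} {zero} λ k _ → inj₂ (inj₁ refl)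
  -- The contribution of the centre is common to both sides, and in the remaining product the
  -- activity and `f` both grow along the order.
  ⊡-mono {f} F {suc i} {suc j} ai≤aj = subst₂ ℚ._≤_ (sym (⊡-suc f i)) (sym (⊡-suc f j))
    (ℚ.+-monoʳ-≤ (1ℚ ℚ.* (a zero ℚ.* f zero))
      (*-mono (F .nonNeg (suc i)) (a-nonNeg (suc j)) ai≤aj (F .mono {suc i} {suc j} ai≤aj)))

-- Passage from rational to real activities.

seq-^ : ∀ x m k → seq (x ^ m) k ≡ seq x k ↑ m
seq-^ x zero    k = refl
seq-^ x (suc m) k = cong (seq x k ℚ.*_) (seq-^ x m k)

seq-product : ∀ (t : Fin q → ℝ) k → seq (productℝ t) k ≡ product λ i → seq (t i) k
seq-product {zero}  t k = refl
seq-product {suc q} t k = cong (seq (t zero) k ℚ.*_) (seq-product (λ i → t (suc i)) k)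

seq-weight : ∀ (a : Fin q → ℝ) (σ : Vec (Fin q) n) k →
             seq (weight a σ) k ≡ weightℚ (λ i → seq (a i) k) σ
seq-weight a σ k = trans (seq-product (λ i → a i ^ Vec.count (i Fin.≟_) σ) k)
  (product-cong λ i → seq-^ (a i) (Vec.count (i Fin.≟_) σ) k)

seq-Z : ∀ (a : Fin q → ℝ) (G : SimpleGraph n) H k → seq (Z a G H) k ≡ Zℚ (λ i → seq (a i) k) G H
seq-Z {q} {n} a G H k = go (Hom G H)
  where
  go : ∀ σs → seq (List.foldr _+_ 0ℝ (List.map (weight a) σs)) k ≡
              List.foldr ℚ._+_ 0ℚ (List.map (weightℚ λ i → seq (a i) k) σs)
  go []       = refl
  go (σ ∷ σs) = cong₂ ℚ._+_ (seq-weight a σ k) (go σs)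

Eventually : (ℕ → Set) → Set
Eventually P = ∃ λ N → ∀ k → N ℕ.≤ k → P k

eventually-map : ∀ {P Q : ℕ → Set} → (∀ {k} → P k → Q k) → Eventually P → Eventually Q
eventually-map P⇒Q (N , PN) = N , λ k N≤k → P⇒Q (PN k N≤k)

eventually-∀ : ∀ {P : Fin q → ℕ → Set} → (∀ i → Eventually (P i)) → Eventually λ k → ∀ i → P i k
eventually-∀ {zero}  ev = 0 , λ _ _ ()
eventually-∀ {suc q} ev with ev zero | eventually-∀ (λ i → ev (suc i))
... | M , PM | N , PN = M ℕ.⊔ N , λ where
  k M⊔N≤k zero    → PM k (ℕ.m⊔n≤o⇒m≤o M N M⊔N≤k)
  k M⊔N≤k (suc i) → PN k (ℕ.m⊔n≤o⇒n≤o M N M⊔N≤k) i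

positive⇒eventually-nonNeg : ∀ x → 0ℝ < x → Eventually λ k → 0ℚ ℚ.≤ seq x k
positive⇒eventually-nonNeg x (δ , 0<δ , N , δ≤x) = N , λ k N≤k →
  ℚ.≤-trans (ℚ.<⇒≤ 0<δ) (ℚ.≤-trans (ℚ.≤-reflexive (sym (ℚ.+-identityˡ δ))) (δ≤x k N≤k))

eventually-≤ : ∀ x y → Eventually (λ k → seq x k ℚ.≤ seq y k) → x ≤ y
eventually-≤ x y (N , x≤y) δ 0<δ = N , λ k N≤k → ℚ.≤-trans (x≤y k N≤k)
  (ℚ.≤-trans (ℚ.≤-reflexive (sym (ℚ.+-identityʳ (seq y k)))) (ℚ.+-monoʳ-≤ (seq y k) (ℚ.<⇒≤ 0<δ)))

↑-nonNeg : ∀ {x} → 0ℚ ℚ.≤ x → ∀ m → 0ℚ ℚ.≤ x ↑ m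
↑-nonNeg 0≤x zero    = ℚ.nonNegative⁻¹ 1ℚ
↑-nonNeg 0≤x (suc m) = *-nonNeg 0≤x (↑-nonNeg 0≤x m)

-- The rational bounds are applied at each late index `k` separately. The order may depend on the
-- activities at that index, so no comparison between reals has to be decided.
path≤tree≤starℝ : ∀ (H : Graph q) (_≼_ : (Fin q → ℚ) → Rel (Fin q) 0ℓ) →
  (∀ a → (∀ i → 0ℚ ℚ.≤ a i) → IsOrderedModel (Colourings.A H) a (_≼_ a)) →
  ∀ (a : Fin q → ℝ) → Eventually (λ k → ∀ i → 0ℚ ℚ.≤ seq (a i) k) →
  1 ℕ.≤ n → (T : SimpleGraph n) → IsTree T →
  Z a (pathGraph n) H ≤ Z a T H × Z a T H ≤ Z a (starGraph n) H
path≤tree≤starℝ {n = suc n} H _≼_ ordered a a-nonNeg _ T isTree =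
  eventually-≤ (Z a (pathGraph (suc n)) H) (Z a T H) (eventually-map (λ {k} 0≤a →
    subst₂ ℚ._≤_ (sym (seq-Z a (pathGraph (suc n)) H k)) (sym (seq-Z a T H k))
      (proj₁ (bounds k 0≤a))) a-nonNeg) ,
  eventually-≤ (Z a T H) (Z a (starGraph (suc n)) H) (eventually-map (λ {k} 0≤a →
    subst₂ ℚ._≤_ (sym (seq-Z a T H k)) (sym (seq-Z a (starGraph (suc n)) H k))
      (proj₂ (bounds k 0≤a))) a-nonNeg)
  where
  bounds : ∀ k → (∀ i → 0ℚ ℚ.≤ seq (a i) k) → _
  bounds k 0≤a = TreePartition.path≤tree≤star H (λ i → seq (a i) k) (ordered _ 0≤a) T isTree

theorem4p19 : (n : ℕ) → 1 ℕ.≤ n →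
    (T : SimpleGraph n) → IsTree T →
    ((x : ℝ) → 0ℝ < x →
    (Z (act-ind x) (pathGraph n) H-ind ≤ Z (act-ind x) T H-ind)
    × (Z (act-ind x) T H-ind ≤ Z (act-ind x) (starGraph n) H-ind))
    ×
    ((k : ℕ) → 1 ℕ.≤ k → (xs : Fin k → ℝ) → (∀ i → 0ℝ < xs i) →
    (Z (act-WR xs) (pathGraph n) (H-WR k) ≤ Z (act-WR xs) T (H-WR k))
    × (Z (act-WR xs) T (H-WR k) ≤ Z (act-WR xs) (starGraph n) (H-WR k)))
    ×
    ((C : ℕ) → 1 ℕ.≤ C → (x : ℝ) → 0ℝ < x →
    (Z (act-cap x) (pathGraph n) (H-cap C) ≤ Z (act-cap x) T (H-cap C))
    × (Z (act-cap x) T (H-cap C) ≤ Z (act-cap x) (starGraph n) (H-cap C)))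
theorem4p19 n 1≤n T isTree =
  (λ x 0<x → path≤tree≤starℝ H-ind (λ _ → _≽_) ind-ordered (act-ind x)
    (eventually-map (λ where
      0≤x zero       → ℚ.nonNegative⁻¹ 1ℚ
      0≤x (suc zero) → 0≤x) (positive⇒eventually-nonNeg x 0<x))
    1≤n T isTree) ,
  -- There are finitely many activities, so all of them are nonnegative from a common index on.
  (λ k _ xs 0<xs → path≤tree≤starℝ (H-WR k) WR-order (WR-ordered k) (act-WR xs)
    (eventually-map (λ where
      0≤xs zero    → ℚ.nonNegative⁻¹ 1ℚ
      0≤xs (suc i) → 0≤xs i) (eventually-∀ λ i → positive⇒eventually-nonNeg (xs i) (0<xs i)))
    1≤n T isTree) ,
  (λ C _ x 0<x → path≤tree≤starℝ (H-cap C) (λ _ → _≽_) (cap-ordered C) (act-cap x)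
    (eventually-map (λ {k} 0≤x i → subst (0ℚ ℚ.≤_) (sym (seq-^ x (toℕ i) k)) (↑-nonNeg 0≤x (toℕ i)))
      (positive⇒eventually-nonNeg x 0<x))
    1≤n T isTree)
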